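{- Let $n, h \ge 1$ and $p \ge 1$ be integers, $\delta$ a real with $0\le\delta < 1/6$, $\mathcal{Z}$ a set, $f:\{0,1\}^p\to\mathcal{Z}$, and $g:\{0,1\}^n\times\{0,1\}^n\to\{0,1\}$ a (possibly partial) function. If $g$ has $(\delta,h)$-hitting monochromatic rectangle-distributions and $p \le 2^{h/2}$, then $$\mathcal{D}^{dt}(f) \le \frac{8}{h}\cdot \mathcal{D}^{cc}(f\circ g^p).$$
   Context: A rectangle $U\times V\subseteq \{0,1\}^n\times\{0,1\}^n$ is $c$-monochromatic (for $c\in\{0,1\}$) if $g(u,v)$ is defined and equals $c$ for all $(u,v)\in U\times V$. A distribution $\sigma$ over rectangles in $\{0,1\}^n\times\{0,1\}^n$ is a $(\delta,h)$-hitting rectangle-distribution if for every $X,Y\subseteq\{0,1\}^n$ with $|X|/2^n\ge 2^{ -h}$ and $|Y|/2^n\ge 2^{ -h}$, $\Pr_{R\sim\sigma}[R\cap(X\times Y)\ne\emptyset]\ge 1-\delta$. $g$ has $(\delta,h)$-hitting monochromatic rectangle-distributions if there are two $(\delta,h)$-hitting rectangle-distributions $\sigma_0,\sigma_1$ such that $\sigma_c$ is supported on $c$-monochromatic rectangles. $f\circ g^p(x,y)=f(g(x_1,y_1),\dots,g(x_p,y_p))$, defined when all $g(x_i,y_i)$ are defined. $\mathcal{D}^{cc}(F)$ is the minimum depth of a deterministic two-party protocol (Alice holds $x$, Bob holds $y$) computing $F$ correctly on its whole domain; $\mathcal{D}^{dt}(f)$ is the minimum depth of a deterministic decision tree computing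 $f$ by querying input bits.
   Formalization: The formal theorem takes δ to be rational and the hitting rectangle-distributions to have rational probabilities, where the English allows real δ and real probabilities. -}

module Defs where

open import Data.Bool using (Bool; true; false; _∧_)
open import Data.Nat using (ℕ; zero; suc; _+_; _*_; _^_; _≤_)
open import Data.Fin using (Fin)
open import Data.Vec using (Vec; []; _∷_; lookup)
open import Data.List using (List; []; _∷_; map; _++_; filter; length; foldr)
open import Data.Bool.ListAction using (any)
open import Data.Maybe using (Maybe; just; nothing)
open import Data.Product using (_×_; _,_; proj₁; proj₂; Σ)
open import Data.Rational using (ℚ; 0ℚ; 1ℚ) renaming (_+_ to _+ℚ_; _≤_ to _≤ℚ_)
open import Data.List.Relation.Unary.All using (All)
open import Relation.Binary.PropositionalEquality using (_≡_)
open import Relation.Nullary.Decidable using (Dec)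
open import Data.Bool.Properties using (T?)
open import Data.Bool using (T)

Bits : ℕ → Set
Bits n = Vec Bool n

allBits : (n : ℕ) → List (Bits n)
allBits zero = [] ∷ []
allBits (suc n) = map (true ∷_) (allBits n) ++ map (false ∷_) (allBits n)

Subset : ℕ → Set
Subset n = Bits n → Bool

card : {n : ℕ} → Subset n → ℕ
card {n} X = length (filter (λ u → T? (X u)) (allBits n))

-- |X| / 2^n ≥ 2^-h   (cleared denominators)
Dense : {n : ℕ} → ℕ → Subset n → Set
Dense {n} h X = 2 ^ n ≤ card X * 2 ^ h

PartialGadget : ℕ → Set
PartialGadget n = Bits n → Bits n → Maybe Bool

Rect : ℕ → Set
Rect n = Subset n × Subset n

Monochromatic : {n : ℕ} → PartialGadget n → Bool → Rect n → Set
Monochromatic g c (U , V) = ∀ u v → U u ≡ true → V v ≡ true → g u v ≡ just c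

intersects : {n : ℕ} → Rect n → Subset n → Subset n → Bool
intersects {n} (U , V) X Y =
  any (λ u → any (λ v → U u ∧ X u ∧ V v ∧ Y v) (allBits n)) (allBits n)

record RectDist (n : ℕ) : Set where
  field
    support  : List (ℚ × Rect n)
    nonneg   : All (λ wr → 0ℚ ≤ℚ proj₁ wr) support
    total    : foldr (λ wr s → proj₁ wr +ℚ s) 0ℚ support ≡ 1ℚ
open RectDist public

Pr : {n : ℕ} → RectDist n → (Rect n → Bool) → ℚ
Pr σ E = foldr (λ wr s → (if E (proj₂ wr) then proj₁ wr else 0ℚ) +ℚ s) 0ℚ (support σ)
  where open import Data.Bool using (if_then_else_)

SupportedOn : {n : ℕ} → RectDist n → (Rect n → Set) → Set
SupportedOn σ P = All (λ wr → P (proj₂ wr)) (support σ)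

Hitting : {n : ℕ} → ℚ → ℕ → RectDist n → Set
Hitting {n} δ h σ =
  (X Y : Subset n) → Dense h X → Dense h Y →
  (1ℚ Data.Rational.- δ) ≤ℚ Pr σ (λ R → intersects R X Y)

HasHittingMonoDists : {n : ℕ} → PartialGadget n → ℚ → ℕ → Set
HasHittingMonoDists {n} g δ h =
  Σ (RectDist n) λ σ₀ → Σ (RectDist n) λ σ₁ →
    (Hitting δ h σ₀ × SupportedOn σ₀ (Monochromatic g false)) ×
    (Hitting δ h σ₁ × SupportedOn σ₁ (Monochromatic g true))

liftG : {n p : ℕ} → PartialGadget n → Vec (Bits n) p → Vec (Bits n) p → Maybe (Vec Bool p)
liftG g [] [] = just []
liftG g (x ∷ xs) (y ∷ ys) with g x y | liftG g xs ys
... | just b | just bs = just (b ∷ bs)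
... | _      | _       = nothing

data DecTree (p : ℕ) (Z : Set) : Set where
  leaf  : Z → DecTree p Z
  query : Fin p → DecTree p Z → DecTree p Z → DecTree p Z   -- (if 0) (if 1)

evalDT : {p : ℕ} {Z : Set} → DecTree p Z → Vec Bool p → Z
evalDT (leaf z) x = z
evalDT (query i t₀ t₁) x with lookup x i
... | false = evalDT t₀ x
... | true  = evalDT t₁ x

depthDT : {p : ℕ} {Z : Set} → DecTree p Z → ℕ
depthDT (leaf _) = 0
depthDT (query _ t₀ t₁) = suc (depthDT t₀ Data.Nat.⊔ depthDT t₁)

data Protocol (A B Z : Set) : Set where
  out   : Z → Protocol A B Z
  alice : (A → Bool) → Protocol A B Z → Protocol A B Z → Protocol A B Z  -- (bit 0) (bit 1)
  bob   : (B → Bool) → Protocol A B Z → Protocol A B Z → Protocol A B Z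

runP : {A B Z : Set} → Protocol A B Z → A → B → Z
runP (out z) a b = z
runP (alice m π₀ π₁) a b with m a
... | false = runP π₀ a b
... | true  = runP π₁ a b
runP (bob m π₀ π₁) a b with m b
... | false = runP π₀ a b
... | true  = runP π₁ a b

depthP : {A B Z : Set} → Protocol A B Z → ℕ
depthP (out _) = 0
depthP (alice _ π₀ π₁) = suc (depthP π₀ Data.Nat.⊔ depthP π₁)
depthP (bob _ π₀ π₁) = suc (depthP π₀ Data.Nat.⊔ depthP π₁)

ComputesComposed : {n p : ℕ} {Z : Set} → (Vec Bool p → Z) → PartialGadget n →
  Protocol (Vec (Bits n) p) (Vec (Bits n) p) Z → Set
ComputesComposed {n} {p} f g Π =
  ∀ (x y : Vec (Bits n) p) (z : Vec Bool p) → liftG g x y ≡ just z → runP Π x y ≡ f z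

ComputesDT : {p : ℕ} {Z : Set} → (Vec Bool p → Z) → DecTree p Z → Set
ComputesDT f T = ∀ x → evalDT T x ≡ f x

{-# OPTIONS --safe #-}
module Submission where

open import Defs
open import Algebra.Bundles using (CommutativeMonoid)
open import Algebra.Definitions.RawMonoid using () renaming (_×_ to multiple)
open import Algebra.Properties.Monoid.Mult using (×-homo-+; ×-assocˡ)
open import Data.Bool as Bool using (Bool; true; false; _∧_; not; if_then_else_)
open import Data.Bool.ListAction using (any)
open import Data.Bool.Properties using (T?; T-≡; ∧-comm)
open import Data.Fin using (Fin; zero; suc; punchIn)
open import Data.Fin.Properties using (any?)
import Data.Integer as ℤ
open import Data.List using (List; []; _∷_; map; _++_; foldr; length; allFin; cartesianProduct; cartesianProductWith; filterᵇ)
open import Data.List.Membership.Propositional using (_∈_; find; lose)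
open import Data.List.Membership.Propositional.Properties using (∈-++⁺ˡ; ∈-++⁺ʳ; ∈-map⁺; ∈-cartesianProductWith⁺; ∈-cartesianProduct⁻; ∈-filter⁻; ∈-allFin)
open import Data.List.Properties using (length-tabulate)
open import Data.List.Relation.Unary.All as All using (All; []; _∷_)
open import Data.List.Relation.Unary.All.Properties using (¬Any⇒All¬)
open import Data.List.Relation.Unary.Any as Any using (here; there)
open import Data.List.Relation.Unary.Any.Properties using (any⁺; any⁻)
open import Data.Maybe using (just)
open import Data.Nat renaming (_/_ to _/ℕ_)
open import Data.Nat.DivMod using (m*n/n≡m; /-monoˡ-≤)
open import Data.Nat.Properties
open import Data.Nat.Tactic.RingSolver using (solve-∀)
open import Data.Product using (Σ; _×_; _,_; proj₁; proj₂; ∃)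
open import Data.Rational using (ℚ; 0ℚ; 1ℚ; _/_) renaming (+-0-rawMonoid to +ℚ-0-rawMonoid; _+_ to _+ℚ_; _-_ to _-ℚ_; _≤_ to _≤ℚ_; _<_ to _<ℚ_)
import Data.Rational.Properties as ℚ
open import Data.Sum using (inj₁; inj₂)
open import Data.Unit using (tt)
open import Data.Vec using (Vec; []; _∷_; lookup; insertAt; removeAt; _[_]≔_; replicate)
open import Data.Vec.Properties using (removeAt-insertAt; insertAt-removeAt; ≡-dec)
open import Function using (_∘_; Equivalence; it)
open import Relation.Binary.PropositionalEquality
open import Relation.Nullary using (Dec; yes; no; ¬_; contradiction; does)
open import Relation.Nullary.Decidable as Dec using (toWitness)

-- A decision tree simulates the protocol on a rectangle A × B of inputs, where A and B are kept
-- thick: every nonempty fibre in a coordinate direction has density at least 2^-h.  Write N = 2^n,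
-- H = 2^h, and A_i for the projection of A forgetting one of the m remaining coordinates, i.
--
-- * If H |A| |B| ≤ 4 m N² |A_i| |B_i| for some i, query i.  Averaging the hitting property over all
--   pairs in A_i × B_i gives a rectangle U × V of the right colour such that the sets A′, B′ of
--   points extended by U and by V satisfy 5 |A_i| |B_i| ≤ 6 |A′| |B′|; they are thick again.
-- * Otherwise follow the next bit into the larger half of A (or B) and delete thin fibres.  Deletion
--   does not decrease H |A| - N Σ_i |A_i|, so the result keeps at least a quarter of |A|.
--
-- As densities never exceed 1, a run with q queries and d bits has
-- (5H)^q ≤ 4^d 24^q p (p-1) ⋯ (p-q+1).  For h ≥ 10 this gives h q ≤ 8 d.  For smaller h it is
-- combined with the observation that d ≤ h forces f to be constant: fixing all coordinates but one,
-- both players retain density 2^-h, so both colours survive at a leaf.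

private
  variable
    X Y S T S′ T′ Z : Set
    m n p : ℕ

-- Indicators and searches in lists

ind : Bool → ℕ
ind true  = 1
ind false = 0

ind-mono : ∀ {a b} → (a ≡ true → b ≡ true) → ind a ≤ ind b
ind-mono {false} _ = z≤n
ind-mono {true}  a⇒b rewrite a⇒b refl = ≤-refl

∧-true⁺ : ∀ {a b} → a ≡ true → b ≡ true → a ∧ b ≡ true
∧-true⁺ refl refl = refl

∧-true⁻ : ∀ {a b} → a ∧ b ≡ true → a ≡ true × b ≡ true
∧-true⁻ {true} {true} _ = refl , refl

any-true⁺ : (P : X → Bool) {xs : List X} {x : X} → x ∈ xs → P x ≡ true → any P xs ≡ true
any-true⁺ P x∈xs Px =
  Equivalence.to T-≡ (any⁺ P (lose x∈xs (Equivalence.from T-≡ Px)))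

any-true⁻ : (P : X → Bool) (xs : List X) → any P xs ≡ true → ∃ λ x → P x ≡ true
any-true⁻ P xs eq with find (any⁻ P xs (Equivalence.from T-≡ eq))
... | x , _ , Px = x , Equivalence.to T-≡ Px

any-mono : {P Q : X → Bool} {xs : List X} → (∀ x → x ∈ xs) →
           (∀ x → P x ≡ true → Q x ≡ true) → any P xs ≡ true → any Q xs ≡ true
any-mono {P = P} {Q} {xs} complete P⊆Q eq with any-true⁻ P xs eq
... | x , Px = any-true⁺ Q (complete x) (P⊆Q x Px)

-- The default `d` makes the choice a total function, so that it can serve as an extension map; its
-- value matters only where the search succeeds.
choose : X → (X → Bool) → List X → X
choose d P []       = d
choose d P (x ∷ xs) = if P x then x else choose d P xs

choose-true : (d : X) (P : X → Bool) (xs : List X) → any P xs ≡ true → P (choose d P xs) ≡ true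
choose-true d P (x ∷ xs) eq with P x in Px
... | true  = Px
... | false = choose-true d P xs eq

-- Finite sums over lists

∑ : List X → (X → ℕ) → ℕ
∑ []       f = 0
∑ (x ∷ xs) f = f x + ∑ xs f

∑-cong : (xs : List X) {f g : X → ℕ} → (∀ x → f x ≡ g x) → ∑ xs f ≡ ∑ xs g
∑-cong []       eq = refl
∑-cong (x ∷ xs) eq = cong₂ _+_ (eq x) (∑-cong xs eq)

∑-mono : (xs : List X) {f g : X → ℕ} → (∀ x → f x ≤ g x) → ∑ xs f ≤ ∑ xs g
∑-mono []       le = z≤n
∑-mono (x ∷ xs) le = +-mono-≤ (le x) (∑-mono xs le)

-- The slack between `k` and `l` is absorbed by the single term at `x`, while all others are
-- compared termwise. With `k = 1` and `l = 0` this yields strict inequalities.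
∑-mono-at : {xs : List X} {f g : X → ℕ} {x : X} {k l : ℕ} → x ∈ xs →
            (∀ y → f y ≤ g y) → k + f x ≤ l + g x → k + ∑ xs f ≤ l + ∑ xs g
∑-mono-at {xs = x ∷ xs} {f} {g} {_} {k} {l} (here refl) le at = begin
  k + (f x + ∑ xs f) ≡⟨ +-assoc k (f x) _ ⟨
  k + f x + ∑ xs f   ≤⟨ +-mono-≤ at (∑-mono xs le) ⟩
  l + g x + ∑ xs g   ≡⟨ +-assoc l (g x) _ ⟩
  l + (g x + ∑ xs g) ∎
  where open ≤-Reasoning
∑-mono-at {xs = y ∷ xs} {f} {g} {_} {k} {l} (there x∈xs) le at = begin
  k + (f y + ∑ xs f) ≡⟨ exch k (f y) (∑ xs f) ⟩
  f y + (k + ∑ xs f) ≤⟨ +-mono-≤ (le y) (∑-mono-at x∈xs le at) ⟩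
  g y + (l + ∑ xs g) ≡⟨ exch l (g y) (∑ xs g) ⟨
  l + (g y + ∑ xs g) ∎
  where
  open ≤-Reasoning
  exch : ∀ a b c → a + (b + c) ≡ b + (a + c)
  exch = solve-∀

∑-+ : (xs : List X) (f g : X → ℕ) → ∑ xs (λ x → f x + g x) ≡ ∑ xs f + ∑ xs g
∑-+ []       f g = refl
∑-+ (x ∷ xs) f g = trans (cong (f x + g x +_) (∑-+ xs f g)) (exch (f x) (g x) _ _)
  where
  exch : ∀ a b c d → a + b + (c + d) ≡ a + c + (b + d)
  exch = solve-∀

∑-*ˡ : (xs : List X) (k : ℕ) (f : X → ℕ) → ∑ xs (λ x → k * f x) ≡ k * ∑ xs f
∑-*ˡ []       k f = sym (*-zeroʳ k)
∑-*ˡ (x ∷ xs) k f = trans (cong (k * f x +_) (∑-*ˡ xs k f)) (sym (*-distribˡ-+ k (f x) _))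

∑-const : (xs : List X) (k : ℕ) → ∑ xs (λ _ → k) ≡ length xs * k
∑-const []       k = refl
∑-const (x ∷ xs) k = cong (k +_) (∑-const xs k)

∑-zero : (xs : List X) → ∑ xs (λ _ → 0) ≡ 0
∑-zero xs = trans (∑-const xs 0) (*-zeroʳ (length xs))

∑-swap : (xs : List X) (ys : List Y) (f : X → Y → ℕ) →
         ∑ xs (λ x → ∑ ys (f x)) ≡ ∑ ys (λ y → ∑ xs (λ x → f x y))
∑-swap []       ys f = sym (∑-zero ys)
∑-swap (x ∷ xs) ys f = trans (cong (∑ ys (f x) +_) (∑-swap xs ys f))
  (sym (∑-+ ys (f x) (λ y → ∑ xs (λ x′ → f x′ y))))

∑-++ : (xs ys : List X) (f : X → ℕ) → ∑ (xs ++ ys) f ≡ ∑ xs f + ∑ ys f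
∑-++ []       ys f = refl
∑-++ (x ∷ xs) ys f = trans (cong (f x +_) (∑-++ xs ys f)) (sym (+-assoc (f x) _ _))

∑-map : (h : X → Y) (xs : List X) (f : Y → ℕ) → ∑ (map h xs) f ≡ ∑ xs (f ∘ h)
∑-map h []       f = refl
∑-map h (x ∷ xs) f = cong (f (h x) +_) (∑-map h xs f)

∑-product : {W : Set} (h : X → Y → W) (xs : List X) (ys : List Y) (f : W → ℕ) →
            ∑ (cartesianProductWith h xs ys) f ≡ ∑ xs (λ x → ∑ ys (λ y → f (h x y)))
∑-product h []       ys f = refl
∑-product h (x ∷ xs) ys f = trans (∑-++ (map (h x) ys) _ f)
  (cong₂ _+_ (∑-map (h x) ys f) (∑-product h xs ys f))

∑-filter≤ : (P : X → Bool) (xs : List X) (f : X → ℕ) → ∑ (filterᵇ P xs) f ≤ ∑ xs f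
∑-filter≤ P []       f = z≤n
∑-filter≤ P (x ∷ xs) f with P x
... | true  = +-monoʳ-≤ (f x) (∑-filter≤ P xs f)
... | false = ≤-trans (∑-filter≤ P xs f) (m≤n+m _ (f x))

length-filterᵇ : (P : X → Bool) (xs : List X) → length (filterᵇ P xs) ≡ ∑ xs (ind ∘ P)
length-filterᵇ P []       = refl
length-filterᵇ P (x ∷ xs) with P x
... | true  = cong suc (length-filterᵇ P xs)
... | false = length-filterᵇ P xs

∑-separate : (xs : List X) (ys : List Y) (f : X → ℕ) (g : Y → ℕ) →
             ∑ xs (λ x → ∑ ys (λ y → f x * g y)) ≡ ∑ xs f * ∑ ys g
∑-separate []       ys f g = refl
∑-separate (x ∷ xs) ys f g = trans
  (cong₂ _+_ (∑-*ˡ ys (f x) g) (∑-separate xs ys f g))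
  (sym (*-distribʳ-+ (∑ ys g) (f x) (∑ xs f)))

-- Enumeration and cardinality of sets of bit strings

∈-allBits : (u : Bits n) → u ∈ allBits n
∈-allBits []          = here refl
∈-allBits (true  ∷ u) = ∈-++⁺ˡ (∈-map⁺ (true ∷_) (∈-allBits u))
∈-allBits {suc n} (false ∷ u) = ∈-++⁺ʳ (map (true ∷_) (allBits n)) (∈-map⁺ (false ∷_) (∈-allBits u))

length≡∑1 : (xs : List X) → length xs ≡ ∑ xs (λ _ → 1)
length≡∑1 xs = sym (trans (∑-const xs 1) (*-identityʳ _))

∑1-allBits : ∀ n → ∑ (allBits n) (λ _ → 1) ≡ 2 ^ n
∑1-allBits zero    = refl
∑1-allBits (suc n) = trans (∑-++ (map (true ∷_) (allBits n)) _ _)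
  (cong₂ _+_ (trans (∑-map (true ∷_) (allBits n) _) (∑1-allBits n))
             (trans (trans (∑-map (false ∷_) (allBits n) _) (∑1-allBits n)) (sym (+-identityʳ _))))

card-∑ : (S : Subset n) → card S ≡ ∑ (allBits n) (ind ∘ S)
card-∑ {n} S = length-filterᵇ S (allBits n)

card≤2^n : (S : Subset n) → card S ≤ 2 ^ n
card≤2^n {n} S = begin
  card S                     ≡⟨ card-∑ S ⟩
  ∑ (allBits n) (ind ∘ S)    ≤⟨ ∑-mono (allBits n) (λ u → ind-mono {S u} {true} (λ _ → refl)) ⟩
  ∑ (allBits n) (λ _ → 1)    ≡⟨ ∑1-allBits n ⟩
  2 ^ n                      ∎
  where open ≤-Reasoning

card-mono : {S S′ : Subset n} → (∀ u → S u ≡ true → S′ u ≡ true) → card S ≤ card S′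
card-mono {n} {S} {S′} S⊆S′ = subst₂ _≤_ (sym (card-∑ S)) (sym (card-∑ S′))
  (∑-mono (allBits n) (λ u → ind-mono (S⊆S′ u)))

-- Sets of vectors of blocks and their projections

VSet : ℕ → ℕ → Set
VSet n m = Vec (Bits n) m → Bool

allVecs : (n m : ℕ) → List (Vec (Bits n) m)
allVecs n zero    = [] ∷ []
allVecs n (suc m) = cartesianProductWith _∷_ (allBits n) (allVecs n m)

∈-allVecs : (x : Vec (Bits n) m) → x ∈ allVecs n m
∈-allVecs []      = here refl
∈-allVecs (u ∷ x) = ∈-cartesianProductWith⁺ _∷_ (∈-allBits u) (∈-allVecs x)

-- Fubini: the sum over entry `i` is moved innermost, so that a set can be counted fibre by fibre in
-- any direction.
∑-insertAt : (i : Fin (suc m)) (f : Vec (Bits n) (suc m) → ℕ) →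
  ∑ (allVecs n (suc m)) f ≡ ∑ (allVecs n m) (λ x → ∑ (allBits n) (λ u → f (insertAt x i u)))
∑-insertAt {m} {n} zero f =
  trans (∑-product _∷_ (allBits n) (allVecs n m) f) (∑-swap (allBits n) (allVecs n m) _)
∑-insertAt {suc m} {n} (suc i) f = begin
  ∑ (allVecs n (2 + m)) f
    ≡⟨ ∑-product _∷_ (allBits n) (allVecs n (suc m)) f ⟩
  ∑ (allBits n) (λ u → ∑ (allVecs n (suc m)) (λ x → f (u ∷ x)))
    ≡⟨ ∑-cong (allBits n) (λ u → ∑-insertAt i (λ x → f (u ∷ x))) ⟩
  ∑ (allBits n) (λ u → ∑ (allVecs n m) (λ x → ∑ (allBits n) (λ v → f (u ∷ insertAt x i v))))
    ≡⟨ ∑-product _∷_ (allBits n) (allVecs n m) _ ⟨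
  ∑ (allVecs n (suc m)) (λ x → ∑ (allBits n) (λ u → f (insertAt x (suc i) u))) ∎
  where open ≡-Reasoning

size : VSet n m → ℕ
size {n} {m} A = ∑ (allVecs n m) (ind ∘ A)

size-mono : {A B : VSet n m} → (∀ x → A x ≡ true → B x ≡ true) → size A ≤ size B
size-mono {n} {m} A⊆B = ∑-mono (allVecs n m) (λ x → ind-mono (A⊆B x))

fibre : VSet n (suc m) → Fin (suc m) → Vec (Bits n) m → Subset n
fibre A i x u = A (insertAt x i u)

proj : Fin (suc m) → VSet n (suc m) → VSet n m
proj {n = n} i A x = any (fibre A i x) (allBits n)

proj-mono : (i : Fin (suc m)) {A B : VSet n (suc m)} → (∀ x → A x ≡ true → B x ≡ true) →
            ∀ x → proj i A x ≡ true → proj i B x ≡ true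
proj-mono i A⊆B x = any-mono ∈-allBits (λ u → A⊆B (insertAt x i u))

size-fibres : (i : Fin (suc m)) (A : VSet n (suc m)) →
              size A ≡ ∑ (allVecs n m) (λ x → card (fibre A i x))
size-fibres {m} {n} i A = trans (∑-insertAt i (ind ∘ A))
  (∑-cong (allVecs n m) (λ x → sym (card-∑ (fibre A i x))))

card-empty : (S : Subset n) → any S (allBits n) ≡ false → card S ≡ 0
card-empty {n} S eq = trans (card-∑ S) (trans (∑-cong (allBits n) zeros) (∑-zero (allBits n)))
  where
  zeros : ∀ u → ind (S u) ≡ 0
  zeros u with S u in Su
  ... | false = refl
  ... | true  with () ← trans (sym (any-true⁺ S (∈-allBits u) Su)) eq

-- A fibre has at most `2 ^ n` points and is empty outside the projection.
size≤proj : (i : Fin (suc m)) (A : VSet n (suc m)) → size A ≤ 2 ^ n * size (proj i A)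
size≤proj {m} {n} i A = begin
  size A
    ≡⟨ size-fibres i A ⟩
  ∑ (allVecs n m) (λ x → card (fibre A i x))
    ≤⟨ ∑-mono (allVecs n m) pointwise ⟩
  ∑ (allVecs n m) (λ x → 2 ^ n * ind (proj i A x))
    ≡⟨ ∑-*ˡ (allVecs n m) (2 ^ n) _ ⟩
  2 ^ n * size (proj i A) ∎
  where
  open ≤-Reasoning
  pointwise : ∀ x → card (fibre A i x) ≤ 2 ^ n * ind (proj i A x)
  pointwise x with proj i A x in eq
  ... | true  = ≤-trans (card≤2^n (fibre A i x)) (≤-reflexive (sym (*-identityʳ _)))
  ... | false = ≤-trans (≤-reflexive (card-empty (fibre A i x) eq)) z≤n

size-full : ∀ n m → size {n} {m} (λ _ → true) ≡ (2 ^ n) ^ m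
size-full n zero    = refl
size-full n (suc m) = begin
  ∑ (allVecs n (suc m)) (λ _ → 1)                     ≡⟨ ∑-product _∷_ (allBits n) (allVecs n m) _ ⟩
  ∑ (allBits n) (λ _ → ∑ (allVecs n m) (λ _ → 1))     ≡⟨ ∑-const (allBits n) _ ⟩
  length (allBits n) * ∑ (allVecs n m) (λ _ → 1)
    ≡⟨ cong₂ _*_ (trans (length≡∑1 (allBits n)) (∑1-allBits n)) (size-full n m) ⟩
  2 ^ n * (2 ^ n) ^ m                                 ∎
  where open ≡-Reasoning

size≤full : (A : VSet n m) → size A ≤ (2 ^ n) ^ m
size≤full {n} {m} A = ≤-trans (size-mono {A = A} (λ _ _ → refl)) (≤-reflexive (size-full n m))

size-nonempty : {A : VSet n m} {x : Vec (Bits n) m} → A x ≡ true → 1 ≤ size A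
size-nonempty {n} {m} {A} {x} Ax = subst (_≤ size A) (cong suc (∑-zero (allVecs n m)))
  (∑-mono-at {f = λ _ → 0} {k = 1} {l = 0} (∈-allVecs x) (λ _ → z≤n)
    (≤-reflexive (cong ind (sym Ax))))

nonempty-size : (A : VSet n m) → 1 ≤ size A → ∃ λ x → A x ≡ true
nonempty-size {n} {m} A 1≤ with any A (allVecs n m) in eq
... | true  = any-true⁻ A (allVecs n m) eq
... | false = contradiction 1≤ (<⇒≱ (s≤s (≤-reflexive (trans (∑-cong (allVecs n m) zeros) (∑-zero (allVecs n m))))))
  where
  zeros : ∀ x → ind (A x) ≡ 0
  zeros x with A x in Ax
  ... | false = refl
  ... | true  with () ← trans (sym (any-true⁺ A (∈-allVecs x) Ax)) eq

-- Fibres and thickness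

insertAt-removeAt-≔ : (x : Vec X (suc m)) (i : Fin (suc m)) (v : X) →
                      insertAt (removeAt x i) i v ≡ x [ i ]≔ v
insertAt-removeAt-≔ (x ∷ xs)         zero    v = refl
insertAt-removeAt-≔ (x ∷ xs@(_ ∷ _)) (suc i) v = cong (x ∷_) (insertAt-removeAt-≔ xs i v)

insertAt-≔ : (x : Vec X m) (i : Fin (suc m)) (u : X) (j : Fin m) (v : X) →
             insertAt x i u [ punchIn i j ]≔ v ≡ insertAt (x [ j ]≔ v) i u
insertAt-≔ xs       zero    u j       v = refl
insertAt-≔ (x ∷ xs) (suc i) u zero    v = refl
insertAt-≔ (x ∷ xs) (suc i) u (suc j) v = cong (x ∷_) (insertAt-≔ xs i u j v)

insertAt-≔-same : (x : Vec X m) (i : Fin (suc m)) (u v : X) →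
                  insertAt x i u [ i ]≔ v ≡ insertAt x i v
insertAt-≔-same xs       zero    u v = refl
insertAt-≔-same (x ∷ xs) (suc i) u v = cong (x ∷_) (insertAt-≔-same xs i u v)

-- A fibre is named by overwriting entry `i` of one of its points, so empty fibres carry no
-- condition and the definition makes sense for every length, including zero.
Thick : ℕ → VSet n m → Set
Thick {m = m} h A = (i : Fin m) → ∀ x → A x ≡ true → Dense h (λ v → A (x [ i ]≔ v))

Dense-mono : (h : ℕ) {S S′ : Subset n} → (∀ u → S u ≡ true → S′ u ≡ true) → Dense h S → Dense h S′
Dense-mono h S⊆S′ dense = ≤-trans dense (*-monoˡ-≤ (2 ^ h) (card-mono S⊆S′))

Thick-fibre : {h : ℕ} {A : VSet n (suc m)} → Thick h A → (i : Fin (suc m)) (x : Vec (Bits n) m) →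
              proj i A x ≡ true → Dense h (fibre A i x)
Thick-fibre {n} {h = h} {A = A} thick i x px with any-true⁻ (fibre A i x) (allBits n) px
... | u , Au = Dense-mono h (λ v → trans (cong A (sym (insertAt-≔-same x i u v)))) (thick i (insertAt x i u) Au)

full-card : ∀ n → card {n} (λ _ → true) ≡ 2 ^ n
full-card n = trans (card-∑ {n} (λ _ → true)) (∑1-allBits n)

full-dense : ∀ n h → Dense {n} h (λ _ → true)
full-dense n h = ≤-trans (≤-reflexive (sym (full-card n))) (m≤m*n _ (2 ^ h) {{m^n≢0 2 h}})

-- Pruning

projSum : VSet n (suc m) → ℕ
projSum {m = m} A = ∑ (allFin (suc m)) (λ i → size (proj i A))

-- The excess is 2^h |A| - 2^n Σ_i |A_i|; both sides are moved so that no subtraction occurs.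
Excess≤ : ℕ → VSet n (suc m) → VSet n (suc m) → Set
Excess≤ {n} h A A′ = 2 ^ h * size A + 2 ^ n * projSum A′ ≤ 2 ^ h * size A′ + 2 ^ n * projSum A

Excess≤-trans : {h : ℕ} {A B C : VSet n (suc m)} → Excess≤ h A B → Excess≤ h B C → Excess≤ h A C
Excess≤-trans {n} {h = h} {A} {B} {C} p q = +-cancelʳ-≤ (b₁ + b₂) _ _ (begin
  a₁ + c₂ + (b₁ + b₂) ≡⟨ exch a₁ c₂ b₁ b₂ ⟩
  a₁ + b₂ + (b₁ + c₂) ≤⟨ +-mono-≤ p q ⟩
  b₁ + a₂ + (c₁ + b₂) ≡⟨ exch′ b₁ a₂ c₁ b₂ ⟩
  c₁ + a₂ + (b₁ + b₂) ∎)
  where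
  open ≤-Reasoning
  a₁ a₂ b₁ b₂ c₁ c₂ : ℕ
  a₁ = 2 ^ h * size A
  a₂ = 2 ^ n * projSum A
  b₁ = 2 ^ h * size B
  b₂ = 2 ^ n * projSum B
  c₁ = 2 ^ h * size C
  c₂ = 2 ^ n * projSum C
  exch : ∀ a c b b′ → a + c + (b + b′) ≡ a + b′ + (b + c)
  exch = solve-∀
  exch′ : ∀ b a c b′ → b + a + (c + b′) ≡ c + a + (b + b′)
  exch′ = solve-∀

_≟ⱽ_ : (x y : Vec (Bits n) m) → Dec (x ≡ y)
_≟ⱽ_ = ≡-dec (≡-dec Bool._≟_)

removeFibre : Fin (suc m) → Vec (Bits n) m → VSet n (suc m) → VSet n (suc m)
removeFibre i x A y = A y ∧ not (does (removeAt y i ≟ⱽ x))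

removeFibre⊆ : (i : Fin (suc m)) (x : Vec (Bits n) m) (A : VSet n (suc m)) →
               ∀ y → removeFibre i x A y ≡ true → A y ≡ true
removeFibre⊆ i x A y eq = proj₁ (∧-true⁻ eq)

removeFibre-same : (i : Fin (suc m)) (x : Vec (Bits n) m) (A : VSet n (suc m)) →
                   ∀ u → removeFibre i x A (insertAt x i u) ≡ false
removeFibre-same i x A u with removeAt (insertAt x i u) i ≟ⱽ x
... | yes _  = ∧-comm (A (insertAt x i u)) false
... | no neq = contradiction (removeAt-insertAt x i u) neq

removeFibre-other : (i : Fin (suc m)) (x : Vec (Bits n) m) (A : VSet n (suc m)) → ∀ y → y ≢ x →
                    ∀ u → A (insertAt y i u) ≡ true → removeFibre i x A (insertAt y i u) ≡ true
removeFibre-other i x A y y≢x u Ay with removeAt (insertAt y i u) i ≟ⱽ x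
... | yes eq = contradiction (trans (sym (removeAt-insertAt y i u)) eq) y≢x
... | no _   = ∧-true⁺ Ay refl

-- Deleting the fibre takes at most `2 ^ n` from `2 ^ h * size A`, while the loss of `x` from
-- projection `i` takes `2 ^ n` from the other term; the remaining projections can only shrink.
removeFibre-excess : {h : ℕ} (i : Fin (suc m)) (x : Vec (Bits n) m) (A : VSet n (suc m)) →
  proj i A x ≡ true → card (fibre A i x) * 2 ^ h ≤ 2 ^ n → Excess≤ h A (removeFibre i x A)
removeFibre-excess {m} {n} {h} i x A px thin = begin
  H * size A + N * projSum A′
    ≡⟨ cong (H * size A +_) (sym (∑-*ˡ (allFin (suc m)) N (λ j → size (proj j A′)))) ⟩
  H * size A + ∑ (allFin (suc m)) (λ j → N * size (proj j A′))
    -- Projection `i` carries the whole gain; every other one is handled by monotonicity.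
    ≤⟨ ∑-mono-at (∈-allFin i) (λ j → *-monoʳ-≤ N (size-mono (proj-mono j (removeFibre⊆ i x A)))) atI ⟩
  H * size A′ + ∑ (allFin (suc m)) (λ j → N * size (proj j A))
    ≡⟨ cong (H * size A′ +_) (∑-*ˡ (allFin (suc m)) N (λ j → size (proj j A))) ⟩
  H * size A′ + N * projSum A ∎
  where
  open ≤-Reasoning
  H N : ℕ
  H = 2 ^ h
  N = 2 ^ n
  A′ : VSet n (suc m)
  A′ = removeFibre i x A
  combine : (B C : VSet n (suc m)) →
    ∑ (allVecs n m) (λ y → H * card (fibre B i y) + N * ind (proj i C y)) ≡ H * size B + N * size (proj i C)
  combine B C = trans (∑-+ (allVecs n m) _ _) (cong₂ _+_
    (trans (∑-*ˡ (allVecs n m) H _) (cong (H *_) (sym (size-fibres i B))))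
    (∑-*ˡ (allVecs n m) N _))
  pointwise : ∀ y → H * card (fibre A i y) + N * ind (proj i A′ y) ≤ H * card (fibre A′ i y) + N * ind (proj i A y)
  pointwise y with y ≟ⱽ x
  ... | no y≢x = +-mono-≤ (*-monoʳ-≤ H (card-mono (removeFibre-other i x A y y≢x)))
                         (*-monoʳ-≤ N (ind-mono (proj-mono i (removeFibre⊆ i x A) y)))
  ... | yes refl with proj i A′ y in eq
  ...   | false rewrite px = begin
    H * card (fibre A i x) + N * 0   ≡⟨ cong₂ _+_ (*-comm H (card (fibre A i x))) (*-zeroʳ N) ⟩
    card (fibre A i x) * H + 0       ≡⟨ +-identityʳ _ ⟩
    card (fibre A i x) * H           ≤⟨ thin ⟩
    N                                ≡⟨ *-identityʳ N ⟨
    N * 1                            ≤⟨ m≤n+m _ _ ⟩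
    H * card (fibre A′ i x) + N * 1  ∎
  ...   | true with any-true⁻ (fibre A′ i y) (allBits n) eq
  ...     | u , A′u with () ← trans (sym A′u) (removeFibre-same i x A u)
  atI : H * size A + N * size (proj i A′) ≤ H * size A′ + N * size (proj i A)
  atI = subst₂ _≤_ (combine A A′) (combine A′ A) (∑-mono (allVecs n m) pointwise)

-- A point of the fibre witnesses the strict decrease, which bounds the number of deletions in
-- `prune`.
removeFibre-size : (i : Fin (suc m)) (x : Vec (Bits n) m) (A : VSet n (suc m)) →
  proj i A x ≡ true → size (removeFibre i x A) < size A
removeFibre-size {m} {n} i x A px with any-true⁻ (fibre A i x) (allBits n) px
... | u , Au = ∑-mono-at {k = 1} {l = 0} (∈-allVecs (insertAt x i u))
  (λ y → ind-mono (removeFibre⊆ i x A y))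
  (≤-reflexive (trans (cong suc (cong ind (removeFibre-same i x A u))) (cong ind (sym Au))))

-- Membership in the projection is part of the test because deleting an empty fibre would make no
-- progress. By the strict comparison, a nonempty fibre that fails the test is `Dense`.
isThin : ℕ → VSet n (suc m) → Fin (suc m) → Vec (Bits n) m → Bool
isThin {n} h A i x = proj i A x ∧ (card (fibre A i x) * 2 ^ h <ᵇ 2 ^ n)

-- Thin fibres are deleted one at a time, since a deletion may create new thin fibres in other
-- directions. Every deletion removes a point, so fuel above `size A` suffices.
prune : (h fuel : ℕ) (A : VSet n (suc m)) → size A < fuel →
  Σ (VSet n (suc m)) λ A′ → (∀ x → A′ x ≡ true → A x ≡ true) × Thick h A′ × Excess≤ h A A′
prune {n} {m} h (suc fuel) A (s≤s size≤) with any? (λ i → any (isThin h A i) (allVecs n m) Bool.≟ true)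
... | yes (i , thin) with any-true⁻ (isThin h A i) (allVecs n m) thin
...   | x , thin-x with ∧-true⁻ {proj i A x} thin-x
...     | px , small with prune h fuel (removeFibre i x A) (<-≤-trans (removeFibre-size i x A px) size≤)
...       | A′ , A′⊆ , thick , excess =
  A′ , (λ y A′y → removeFibre⊆ i x A y (A′⊆ y A′y)) , thick ,
  Excess≤-trans {h = h} {A} {removeFibre i x A} {A′}
    (removeFibre-excess {h = h} i x A px (<⇒≤ (<ᵇ⇒< _ _ (Equivalence.from T-≡ small)))) excess
prune {n} {m} h (suc fuel) A _ | no none = A , (λ _ Ax → Ax) , thick , ≤-refl
  where
  thick : Thick h A
  thick i x Ax = Dense-mono h (λ v → trans (cong A (sym (insertAt-removeAt-≔ x i v))))
                  -- A thin fibre through `x` would have been found by the search.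
                  (≮⇒≥ λ lt → none (i , any-true⁺ (isThin h A i) (∈-allVecs (removeAt x i))
                    (∧-true⁺ here! (Equivalence.to T-≡ (<⇒<ᵇ lt)))))
    where
    here! : proj i A (removeAt x i) ≡ true
    here! = any-true⁺ (fibre A i (removeAt x i)) (∈-allBits (lookup x i))
              (trans (cong A (insertAt-removeAt x i)) Ax)

-- Expectations over rectangle distributions

infixr 8 _·_

-- Natural multiples are repeated sums, which keeps counts in ℕ and avoids embedding them in ℚ.
_·_ : ℕ → ℚ → ℚ
_·_ = multiple +ℚ-0-rawMonoid

·-monoʳ-≤ : ∀ k {p q} → p ≤ℚ q → k · p ≤ℚ k · q
·-monoʳ-≤ zero    p≤q = ℚ.≤-refl
·-monoʳ-≤ (suc k) p≤q = ℚ.+-mono-≤ p≤q (·-monoʳ-≤ k p≤q)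

·-monoʳ-< : ∀ k {p q} → p <ℚ q → suc k · p <ℚ suc k · q
·-monoʳ-< k p<q = ℚ.+-mono-<-≤ p<q (·-monoʳ-≤ k (ℚ.<⇒≤ p<q))

·-nonneg : ∀ k {p} → 0ℚ ≤ℚ p → 0ℚ ≤ℚ k · p
·-nonneg zero    0≤p = ℚ.≤-refl
·-nonneg (suc k) 0≤p = ℚ.+-mono-≤ 0≤p (·-nonneg k 0≤p)

·-monoˡ-≤ : ∀ {k l p} → 0ℚ ≤ℚ p → k ≤ l → k · p ≤ℚ l · p
·-monoˡ-≤ {l = l} 0≤p z≤n       = ·-nonneg l 0≤p
·-monoˡ-≤ {p = p} 0≤p (s≤s k≤l) = ℚ.+-monoʳ-≤ p (·-monoˡ-≤ 0≤p k≤l)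

expect : {n : ℕ} → List (ℚ × Rect n) → (Rect n → ℕ) → ℚ
expect ws F = foldr (λ wr s → F (proj₂ wr) · proj₁ wr +ℚ s) 0ℚ ws

expect-+ : (ws : List (ℚ × Rect n)) (F G : Rect n → ℕ) →
           expect ws (λ R → F R + G R) ≡ expect ws F +ℚ expect ws G
expect-+ []             F G = refl
expect-+ ((w , R) ∷ ws) F G = trans
  (cong₂ _+ℚ_ (×-homo-+ ℚ.+-0-monoid w (F R) (G R)) (expect-+ ws F G))
  (interchange (F R · w) (G R · w) (expect ws F) (expect ws G))
  where
  open import Algebra.Properties.CommutativeSemigroup (CommutativeMonoid.commutativeSemigroup ℚ.+-0-commutativeMonoid) using (interchange)

expect-* : (ws : List (ℚ × Rect n)) (k : ℕ) (F : Rect n → ℕ) →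
           expect ws (λ R → k * F R) ≡ k · expect ws F
expect-* ws zero    F = zeros ws
  where
  zeros : ∀ ws → expect ws (λ R → 0) ≡ 0ℚ
  zeros []       = refl
  zeros (w ∷ ws) = trans (ℚ.+-identityˡ _) (zeros ws)
expect-* ws (suc k) F = trans (expect-+ ws F (λ R → k * F R)) (cong (expect ws F +ℚ_) (expect-* ws k F))

expect-mono : {ws : List (ℚ × Rect n)} {F G : Rect n → ℕ} → All (λ wr → 0ℚ ≤ℚ proj₁ wr) ws →
  All (λ wr → F (proj₂ wr) ≤ G (proj₂ wr)) ws → expect ws F ≤ℚ expect ws G
expect-mono []         []         = ℚ.≤-refl
expect-mono (0≤w ∷ ps) (le ∷ les) = ℚ.+-mono-≤ (·-monoˡ-≤ 0≤w le) (expect-mono ps les)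

expect-ind : (ws : List (ℚ × Rect n)) (E : Rect n → Bool) →
  expect ws (ind ∘ E) ≡ foldr (λ wr s → (if E (proj₂ wr) then proj₁ wr else 0ℚ) +ℚ s) 0ℚ ws
expect-ind []             E = refl
expect-ind ((w , R) ∷ ws) E with E R
... | true  = cong₂ _+ℚ_ (ℚ.+-identityʳ w) (expect-ind ws E)
... | false = cong (0ℚ +ℚ_) (expect-ind ws E)

expect-one : (ws : List (ℚ × Rect n)) → expect ws (λ _ → 1) ≡ foldr (λ wr s → proj₁ wr +ℚ s) 0ℚ ws
expect-one []             = refl
expect-one ((w , R) ∷ ws) = cong₂ _+ℚ_ (ℚ.+-identityʳ w) (expect-one ws)

-- Linearity of expectation: the expected number of events that occur is the sum of their
-- probabilities, each at least `q`.
expect-hits : (σ : RectDist n) (E : X → Rect n → Bool) {q : ℚ} (ks : List X) →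
  All (λ k → q ≤ℚ Pr σ (E k)) ks → length ks · q ≤ℚ expect (support σ) (λ R → ∑ ks (λ k → ind (E k R)))
expect-hits σ E []       []         = ℚ.≤-reflexive (sym (expect-* (support σ) 0 (λ _ → 0)))
expect-hits σ E (k ∷ ks) (le ∷ les) = ℚ.≤-trans
  (ℚ.+-mono-≤ (ℚ.≤-trans le (ℚ.≤-reflexive (sym (expect-ind (support σ) (E k))))) (expect-hits σ E ks les))
  (ℚ.≤-reflexive (sym (expect-+ (support σ) (λ R → ind (E k R)) _)))

-- Averaging: if every rectangle of the support missed more than a sixth of the events, the expected
-- number that occur would be at most five sixths of all, whereas the hypothesis makes it at least
-- `1 - δ` of all, which is more.
good-rectangle : (σ : RectDist n) {δ : ℚ} → δ <ℚ (ℤ.+ 1 / 6) → (E : X → Rect n → Bool) (ks : List X) →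
  1 ≤ length ks → All (λ k → 1ℚ -ℚ δ ≤ℚ Pr σ (E k)) ks →
  ∃ λ wr → wr ∈ support σ × 5 * length ks ≤ 6 * ∑ ks (λ k → ind (E k (proj₂ wr)))
good-rectangle σ {δ} δ< E ks 1≤ hits
  with Any.any? (λ wr → 5 * length ks ≤? 6 * ∑ ks (λ k → ind (E k (proj₂ wr)))) (support σ)
... | yes found = find found
... | no none   = contradiction (ℚ.<-≤-trans (strict (length ks) 1≤) too-small) (ℚ.<-irrefl refl)
  where
  hit : Rect _ → ℕ
  hit R = ∑ ks (λ k → ind (E k R))
  ·-swap : ∀ k l q → k · l · q ≡ l · k · q
  ·-swap k l q = trans (×-assocˡ ℚ.+-0-monoid q k l)
    (trans (cong (_· q) (*-comm k l)) (sym (×-assocˡ ℚ.+-0-monoid q l k)))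
  too-small : length ks · 6 · (1ℚ -ℚ δ) ≤ℚ length ks · 5 · 1ℚ
  too-small = begin
    length ks · 6 · (1ℚ -ℚ δ)                 ≡⟨ ·-swap (length ks) 6 (1ℚ -ℚ δ) ⟩
    6 · length ks · (1ℚ -ℚ δ)                 ≤⟨ ·-monoʳ-≤ 6 (expect-hits σ E ks hits) ⟩
    6 · expect (support σ) hit                ≡⟨ expect-* (support σ) 6 hit ⟨
    expect (support σ) (λ R → 6 * hit R)      ≤⟨ expect-mono (nonneg σ) (All.map (<⇒≤ ∘ ≰⇒>) (¬Any⇒All¬ _ none)) ⟩
    expect (support σ) (λ R → 5 * length ks)  ≡⟨ cong (λ k → expect (support σ) (λ _ → k)) (*-identityʳ (5 * length ks)) ⟨
    expect (support σ) (λ R → 5 * length ks * 1) ≡⟨ expect-* (support σ) (5 * length ks) (λ _ → 1) ⟩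
    (5 * length ks) · expect (support σ) (λ _ → 1) ≡⟨ cong ((5 * length ks) ·_) (trans (expect-one (support σ)) (total σ)) ⟩
    (5 * length ks) · 1ℚ                      ≡⟨ ×-assocˡ ℚ.+-0-monoid 1ℚ 5 (length ks) ⟨
    5 · length ks · 1ℚ                        ≡⟨ ·-swap 5 (length ks) 1ℚ ⟩
    length ks · 5 · 1ℚ                        ∎
    where open ℚ.≤-Reasoning
  strict : ∀ l → 1 ≤ l → l · 5 · 1ℚ <ℚ l · 6 · (1ℚ -ℚ δ)
  -- `6 · (1ℚ - 1/6)` evaluates to `5 · 1ℚ`, so `δ < 1/6` gives the strict inequality; the outer
  -- factor is positive because the list is nonempty.
  strict (suc l) _ = ·-monoʳ-< l (·-monoʳ-< 5 {1ℚ -ℚ (ℤ.+ 1 / 6)} (ℚ.+-monoʳ-< 1ℚ (ℚ.neg-antimono-< δ<)))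

-- Protocols and decision trees

mapP : (S′ → S) → (T′ → T) → Protocol S T Z → Protocol S′ T′ Z
mapP φ ψ (out z)         = out z
mapP φ ψ (alice μ Π₀ Π₁) = alice (μ ∘ φ) (mapP φ ψ Π₀) (mapP φ ψ Π₁)
mapP φ ψ (bob μ Π₀ Π₁)   = bob (μ ∘ ψ) (mapP φ ψ Π₀) (mapP φ ψ Π₁)

runP-mapP : (φ : S′ → S) (ψ : T′ → T) (Π : Protocol S T Z) →
            ∀ a b → runP (mapP φ ψ Π) a b ≡ runP Π (φ a) (ψ b)
runP-mapP φ ψ (out z)         a b = refl
runP-mapP φ ψ (alice μ Π₀ Π₁) a b with μ (φ a)
... | false = runP-mapP φ ψ Π₀ a b
... | true  = runP-mapP φ ψ Π₁ a b
runP-mapP φ ψ (bob μ Π₀ Π₁)   a b with μ (ψ b)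
... | false = runP-mapP φ ψ Π₀ a b
... | true  = runP-mapP φ ψ Π₁ a b

depthP-mapP : (φ : S′ → S) (ψ : T′ → T) (Π : Protocol S T Z) → depthP (mapP φ ψ Π) ≡ depthP Π
depthP-mapP φ ψ (out z)         = refl
depthP-mapP φ ψ (alice μ Π₀ Π₁) = cong suc (cong₂ _⊔_ (depthP-mapP φ ψ Π₀) (depthP-mapP φ ψ Π₁))
depthP-mapP φ ψ (bob μ Π₀ Π₁)   = cong suc (cong₂ _⊔_ (depthP-mapP φ ψ Π₀) (depthP-mapP φ ψ Π₁))

branch : Bool → Protocol S T Z → Protocol S T Z → Protocol S T Z
branch false Π₀ Π₁ = Π₀
branch true  Π₀ Π₁ = Π₁

runP-alice : (μ : S → Bool) {Π₀ Π₁ : Protocol S T Z} {b : Bool} → ∀ x y → μ x ≡ b →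
             runP (alice μ Π₀ Π₁) x y ≡ runP (branch b Π₀ Π₁) x y
runP-alice μ {b = false} x y eq rewrite eq = refl
runP-alice μ {b = true} x y eq rewrite eq = refl

runP-bob : (μ : T → Bool) {Π₀ Π₁ : Protocol S T Z} {b : Bool} → ∀ x y → μ y ≡ b →
           runP (bob μ Π₀ Π₁) x y ≡ runP (branch b Π₀ Π₁) x y
runP-bob μ {b = false} x y eq rewrite eq = refl
runP-bob μ {b = true} x y eq rewrite eq = refl

depthP-branch : (b : Bool) (Π₀ Π₁ : Protocol S T Z) → depthP (branch b Π₀ Π₁) ≤ depthP Π₀ ⊔ depthP Π₁
depthP-branch false Π₀ Π₁ = m≤m⊔n _ _
depthP-branch true  Π₀ Π₁ = m≤n⊔m _ _

renameDT : (Fin m → Fin p) → DecTree m Z → DecTree p Z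
renameDT ρ (leaf z)        = leaf z
renameDT ρ (query i t₀ t₁) = query (ρ i) (renameDT ρ t₀) (renameDT ρ t₁)

depthDT-renameDT : (ρ : Fin m → Fin p) (t : DecTree m Z) → depthDT (renameDT ρ t) ≡ depthDT t
depthDT-renameDT ρ (leaf z)        = refl
depthDT-renameDT ρ (query i t₀ t₁) = cong suc (cong₂ _⊔_ (depthDT-renameDT ρ t₀) (depthDT-renameDT ρ t₁))

lookup-removeAt : (x : Vec S (suc m)) (i : Fin (suc m)) (j : Fin m) →
                  lookup (removeAt x i) j ≡ lookup x (punchIn i j)
lookup-removeAt (x ∷ xs)         zero    j       = refl
lookup-removeAt (x ∷ xs@(_ ∷ _)) (suc i) zero    = refl
lookup-removeAt (x ∷ xs@(_ ∷ _)) (suc i) (suc j) = lookup-removeAt xs i j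

evalDT-renameDT : (i : Fin (suc m)) (t : DecTree m Z) → ∀ x → evalDT (renameDT (punchIn i) t) x ≡ evalDT t (removeAt x i)
evalDT-renameDT i (leaf z)        x = refl
evalDT-renameDT i (query j t₀ t₁) x rewrite lookup-removeAt x i j with lookup x (punchIn i j)
... | false = evalDT-renameDT i t₀ x
... | true  = evalDT-renameDT i t₁ x

queryAt : Fin (suc m) → (Bool → DecTree m Z) → DecTree (suc m) Z
queryAt i t = query i (renameDT (punchIn i) (t false)) (renameDT (punchIn i) (t true))

queryAt-computes : (f : Vec Bool (suc m) → Z) (i : Fin (suc m)) (t : Bool → DecTree m Z) →
  (∀ c → ComputesDT (λ z → f (insertAt z i c)) (t c)) → ComputesDT f (queryAt i t)
queryAt-computes f i t correct x with lookup x i in eq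
... | false = trans (evalDT-renameDT i (t false) x) (trans (correct false (removeAt x i))
                (cong f (trans (cong (insertAt (removeAt x i) i) (sym eq)) (insertAt-removeAt x i))))
... | true  = trans (evalDT-renameDT i (t true) x) (trans (correct true (removeAt x i))
                (cong f (trans (cong (insertAt (removeAt x i) i) (sym eq)) (insertAt-removeAt x i))))

-- The potential bound speaks of depth only, so it suffices to follow the answer with the deeper
-- subtree.
queryAt-depth : (i : Fin (suc m)) (t : Bool → DecTree m Z) → ∃ λ c → depthDT (queryAt i t) ≡ suc (depthDT (t c))
queryAt-depth i t with ⊔-sel (depthDT (t false)) (depthDT (t true))
... | inj₁ eq = false , cong suc (trans (cong₂ _⊔_ (depthDT-renameDT _ (t false)) (depthDT-renameDT _ (t true))) eq)
... | inj₂ eq = true  , cong suc (trans (cong₂ _⊔_ (depthDT-renameDT _ (t false)) (depthDT-renameDT _ (t true))) eq)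

liftG-insertAt : (g : PartialGadget n) (i : Fin (suc m)) (x y : Vec (Bits n) m) {z : Vec Bool m}
  {u v : Bits n} {c : Bool} → liftG g x y ≡ just z → g u v ≡ just c →
  liftG g (insertAt x i u) (insertAt y i v) ≡ just (insertAt z i c)
liftG-insertAt g zero x y xy≡z uv≡c rewrite uv≡c | xy≡z = refl
liftG-insertAt g (suc i) (x ∷ xs) (y ∷ ys) {z} xy≡z uv≡c with g x y | liftG g xs ys in eq
liftG-insertAt g (suc i) (x ∷ xs) (y ∷ ys) refl uv≡c | just b | just bs
  rewrite liftG-insertAt g i xs ys eq uv≡c = refl

-- Hitting rectangles and projections

ColourDist : PartialGadget n → ℚ → ℕ → Bool → Set
ColourDist {n} g δ h c = Σ (RectDist n) λ σ → Hitting δ h σ × SupportedOn σ (Monochromatic g c)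

through : Subset n → Fin (suc m) → VSet n (suc m) → VSet n m
through {n} U i A x = any (λ u → U u ∧ fibre A i x u) (allBits n)

entry : Subset n → Fin (suc m) → VSet n (suc m) → Vec (Bits n) m → Bits n
entry {n} U i A x = choose (replicate n false) (λ u → U u ∧ fibre A i x u) (allBits n)

entry∈ : (U : Subset n) (i : Fin (suc m)) (A : VSet n (suc m)) → ∀ x → through U i A x ≡ true →
         U (entry U i A x) ≡ true × A (insertAt x i (entry U i A x)) ≡ true
entry∈ {n} U i A x eq = ∧-true⁻ (choose-true (replicate n false) (λ u → U u ∧ fibre A i x u) (allBits n) eq)

-- The entry u of x in U stays available when another coordinate of x is changed within a fibre of A.
through-thick : {h : ℕ} (U : Subset n) (i : Fin (suc m)) (A : VSet n (suc m)) → Thick h A → Thick h (through U i A)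
through-thick {h = h} U i A thick j x Tx with entry∈ U i A x Tx
... | Uu , Au = Dense-mono h
  (λ v Av → any-true⁺ (λ u → U u ∧ fibre A i (x [ j ]≔ v) u) (∈-allBits (entry U i A x))
    (∧-true⁺ Uu (trans (cong A (sym (insertAt-≔ x i (entry U i A x) j v))) Av)))
  (thick (punchIn i j) (insertAt x i (entry U i A x)) Au)

-- If the rectangle meets a product of fibres, then `U` meets the first and `V` the second. The
-- bound is a product, so that summing it over all pairs gives the size of a rectangle again.
intersects-through : (U V : Subset n) (i : Fin (suc m)) (A B : VSet n (suc m)) (x y : Vec (Bits n) m) →
  ind (intersects (U , V) (fibre A i x) (fibre B i y)) ≤ ind (through U i A x) * ind (through V i B y)
intersects-through {n} U V i A B x y with intersects (U , V) (fibre A i x) (fibre B i y) in eq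
... | false = z≤n
... | true  with any-true⁻ _ (allBits n) eq
...   | u , eqᵤ with any-true⁻ _ (allBits n) eqᵤ
...     | v , eqᵥ with ∧-true⁻ {U u} eqᵥ
...       | Uu , eq′ with ∧-true⁻ {fibre A i x u} eq′
...         | Au , VBv
  rewrite any-true⁺ (λ u → U u ∧ fibre A i x u) (∈-allBits u) (∧-true⁺ Uu Au)
        | any-true⁺ (λ v → V v ∧ fibre B i y v) (∈-allBits v) VBv = ≤-refl

positive-factorʳ : ∀ k l → 1 ≤ k * l → 1 ≤ l
positive-factorʳ k zero    le = subst (1 ≤_) (*-zeroʳ k) le
positive-factorʳ k (suc l) le = s≤s z≤n

positive-factorˡ : ∀ k l → 1 ≤ k * l → 1 ≤ k
positive-factorˡ (suc k) l le = s≤s z≤n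

proj-positive : (i : Fin (suc m)) (A : VSet n (suc m)) → 1 ≤ size A → 1 ≤ size (proj i A)
proj-positive {n = n} i A 1≤ = positive-factorʳ (2 ^ n) _ (≤-trans 1≤ (size≤proj i A))

-- `u` and `v` give the missing block as a function of a player's own remaining blocks, so it is
-- filled in without communication. `gain` is the hitting fraction of five sixths with denominators
-- cleared.
record Restriction {n m : ℕ} (h : ℕ) (g : PartialGadget n) (c : Bool) (i : Fin (suc m))
                   (A B : VSet n (suc m)) : Set where
  field
    A′ B′   : VSet n m
    u v     : Vec (Bits n) m → Bits n
    u∈      : ∀ x → A′ x ≡ true → A (insertAt x i (u x)) ≡ true
    v∈      : ∀ y → B′ y ≡ true → B (insertAt y i (v y)) ≡ true
    colour  : ∀ x y → A′ x ≡ true → B′ y ≡ true → g (u x) (v y) ≡ just c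
    thickA′ : Thick h A′
    thickB′ : Thick h B′
    gain    : 5 * (size (proj i A) * size (proj i B)) ≤ 6 * (size A′ * size B′)

-- Thickness makes every pair of fibres over the two projections dense, so one rectangle hits at
-- least five sixths of these pairs, and each pair it hits survives in `through U i A` and
-- `through V i B`.
restrict : {g : PartialGadget n} {δ : ℚ} {h : ℕ} {c : Bool} → δ <ℚ (ℤ.+ 1 / 6) → ColourDist g δ h c →
  (i : Fin (suc m)) (A B : VSet n (suc m)) → Thick h A → Thick h B → 1 ≤ size A → 1 ≤ size B →
  Restriction h g c i A B
restrict {n} {m} {g} {δ} {h} {c} δ< (σ , hitting , mono) i A B thickA thickB 1≤A 1≤B = restriction
  where
  xs ys : List (Vec (Bits n) m)
  xs = filterᵇ (proj i A) (allVecs n m)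
  ys = filterᵇ (proj i B) (allVecs n m)
  pairs : List (Vec (Bits n) m × Vec (Bits n) m)
  pairs = cartesianProduct xs ys
  meets : Vec (Bits n) m × Vec (Bits n) m → Rect n → Bool
  meets (x , y) R = intersects R (fibre A i x) (fibre B i y)
  #pairs : length pairs ≡ size (proj i A) * size (proj i B)
  #pairs = begin
    length pairs                           ≡⟨ length≡∑1 pairs ⟩
    ∑ pairs (λ _ → 1)                      ≡⟨ ∑-product _,_ xs ys _ ⟩
    ∑ xs (λ _ → ∑ ys (λ _ → 1))            ≡⟨ ∑-const xs _ ⟩
    length xs * ∑ ys (λ _ → 1)             ≡⟨ cong (length xs *_) (length≡∑1 ys) ⟨
    length xs * length ys                  ≡⟨ cong₂ _*_ (length-filterᵇ (proj i A) (allVecs n m))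
                                                     (length-filterᵇ (proj i B) (allVecs n m)) ⟩
    size (proj i A) * size (proj i B)      ∎
    where open ≡-Reasoning
  dense : ∀ {x y} → (x , y) ∈ pairs → Dense h (fibre A i x) × Dense h (fibre B i y)
  dense xy∈ with ∈-cartesianProduct⁻ xs ys xy∈
  ... | x∈ , y∈ =
    Thick-fibre {h = h} thickA i _ (Equivalence.to T-≡ (proj₂ (∈-filter⁻ (T? ∘ proj i A) {xs = allVecs n m} x∈))) ,
    Thick-fibre {h = h} thickB i _ (Equivalence.to T-≡ (proj₂ (∈-filter⁻ (T? ∘ proj i B) {xs = allVecs n m} y∈)))
  good : ∃ λ wr → wr ∈ support σ × 5 * length pairs ≤ 6 * ∑ pairs (λ k → ind (meets k (proj₂ wr)))
  good = good-rectangle σ δ< meets pairs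
    (subst (1 ≤_) (sym #pairs) (*-mono-≤ (proj-positive i A 1≤A) (proj-positive i B 1≤B)))
    (All.tabulate λ {k} k∈ → let (dX , dY) = dense k∈ in hitting _ _ dX dY)
  U V : Subset n
  U = proj₁ (proj₂ (proj₁ good))
  V = proj₂ (proj₂ (proj₁ good))
  hits≤ : ∑ pairs (λ k → ind (meets k (U , V))) ≤ size (through U i A) * size (through V i B)
  hits≤ = begin
    ∑ pairs (λ k → ind (meets k (U , V)))
      ≡⟨ ∑-product _,_ xs ys _ ⟩
    ∑ xs (λ x → ∑ ys (λ y → ind (meets (x , y) (U , V))))
      ≤⟨ ∑-mono xs (λ x → ∑-mono ys (λ y → intersects-through U V i A B x y)) ⟩
    ∑ xs (λ x → ∑ ys (λ y → ind (through U i A x) * ind (through V i B y)))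
      ≡⟨ ∑-separate xs ys _ _ ⟩
    ∑ xs (ind ∘ through U i A) * ∑ ys (ind ∘ through V i B)
      ≤⟨ *-mono-≤ (∑-filter≤ (proj i A) (allVecs n m) _) (∑-filter≤ (proj i B) (allVecs n m) _) ⟩
    size (through U i A) * size (through V i B) ∎
    where open ≤-Reasoning
  restriction : Restriction h g c i A B
  restriction = record
    { A′ = through U i A
    ; B′ = through V i B
    ; u = entry U i A
    ; v = entry V i B
    ; u∈ = λ x Tx → proj₂ (entry∈ U i A x Tx)
    ; v∈ = λ y Ty → proj₂ (entry∈ V i B y Ty)
    ; colour = λ x y Tx Ty → All.lookup mono (proj₁ (proj₂ good)) _ _
                 (proj₁ (entry∈ U i A x Tx)) (proj₁ (entry∈ V i B y Ty))
    ; thickA′ = through-thick {h = h} U i A thickA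
    ; thickB′ = through-thick {h = h} V i B thickB
    ; gain = ≤-trans (≤-trans (≤-reflexive (cong (5 *_) (sym #pairs))) (proj₂ (proj₂ good))) (*-monoʳ-≤ 6 hits≤)
    }

-- Communicated bits

-- The two parts sum to the whole, so one of them has at least half. The list is arbitrary because
-- the lemma serves both for whole inputs and, in `confuse`, for a single block.
larger-part : (xs : List S) (P μ : S → Bool) → Σ Bool λ b → Σ (S → Bool) λ P′ →
  (∀ x → P′ x ≡ true → P x ≡ true × μ x ≡ b) × ∑ xs (ind ∘ P) ≤ 2 * ∑ xs (ind ∘ P′)
larger-part {S} xs P μ = result
  where
  part : Bool → S → Bool
  part true  x = P x ∧ μ x
  part false x = P x ∧ not (μ x)
  part⊆ : ∀ b x → part b x ≡ true → P x ≡ true × μ x ≡ b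
  part⊆ true  x eq = ∧-true⁻ eq
  part⊆ false x eq with P x | μ x
  ... | true | false = refl , refl
  pointwise : ∀ x → ind (P x) ≡ ind (part true x) + ind (part false x)
  pointwise x with P x | μ x
  ... | false | _     = refl
  ... | true  | true  = refl
  ... | true  | false = refl
  #part : Bool → ℕ
  #part b = ∑ xs (ind ∘ part b)
  split : ∑ xs (ind ∘ P) ≡ #part true + #part false
  split = trans (∑-cong xs pointwise) (∑-+ xs (ind ∘ part true) (ind ∘ part false))
  result : Σ Bool λ b → Σ (S → Bool) λ P′ →
    (∀ x → P′ x ≡ true → P x ≡ true × μ x ≡ b) × ∑ xs (ind ∘ P) ≤ 2 * ∑ xs (ind ∘ P′)
  result with ≤-total (#part true) (#part false)
  ... | inj₁ t≤f = false , part false , part⊆ false , ≤-trans (≤-reflexive split) (+-mono-≤ t≤f (m≤m+n _ 0))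
  ... | inj₂ f≤t = true , part true , part⊆ true ,
                   ≤-trans (≤-reflexive split) (+-monoʳ-≤ (#part true) (≤-trans f≤t (m≤m+n _ 0)))

-- The excess of the larger half is at least `H * size A / 2` minus the projection term, which by
-- `spread` is at most `H * size A / 4`. Pruning does not lower the excess, so a quarter of `A`
-- survives.
halve : (h : ℕ) (A : VSet n (suc m)) (μ : Vec (Bits n) (suc m) → Bool) →
  (∀ i → 4 * (suc m * (2 ^ n * size (proj i A))) ≤ 2 ^ h * size A) →
  Σ Bool λ b → Σ (VSet n (suc m)) λ A′ → (∀ x → A′ x ≡ true → A x ≡ true × μ x ≡ b) ×
    Thick h A′ × size A ≤ 4 * size A′
halve {n} {m} h A μ spread = result
  where
  H N : ℕ
  H = 2 ^ h
  N = 2 ^ n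
  half : Σ Bool λ b → Σ (VSet n (suc m)) λ P → (∀ x → P x ≡ true → A x ≡ true × μ x ≡ b) × size A ≤ 2 * size P
  half = larger-part (allVecs n (suc m)) A μ
  b : Bool
  b = proj₁ half
  P : VSet n (suc m)
  P = proj₁ (proj₂ half)
  P⊆ : ∀ x → P x ≡ true → A x ≡ true × μ x ≡ b
  P⊆ = proj₁ (proj₂ (proj₂ half))
  A≤2P : size A ≤ 2 * size P
  A≤2P = proj₂ (proj₂ (proj₂ half))
  projSum≤ : 4 * (N * projSum A) ≤ H * size A
  -- `spread` is summed over all `suc m` directions and the common factor `suc m` cancelled.
  projSum≤ = *-cancelˡ-≤ (suc m) (begin
    suc m * (4 * (N * projSum A))
      ≡⟨ rearrange (suc m) N (projSum A) ⟩
    4 * (suc m * N) * projSum A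
      ≡⟨ ∑-*ˡ (allFin (suc m)) (4 * (suc m * N)) (λ i → size (proj i A)) ⟨
    ∑ (allFin (suc m)) (λ i → 4 * (suc m * N) * size (proj i A))
      ≤⟨ ∑-mono (allFin (suc m)) (λ i → ≤-trans (≤-reflexive (rearrange′ (suc m) N (size (proj i A)))) (spread i)) ⟩
    ∑ (allFin (suc m)) (λ i → H * size A)
      ≡⟨ ∑-const (allFin (suc m)) (H * size A) ⟩
    length (allFin (suc m)) * (H * size A)
      ≡⟨ cong (_* (H * size A)) (length-tabulate {n = suc m} (λ i → i)) ⟩
    suc m * (H * size A) ∎)
    where
    open ≤-Reasoning
    rearrange : ∀ k N s → k * (4 * (N * s)) ≡ 4 * (k * N) * s
    rearrange = solve-∀
    rearrange′ : ∀ k N s → 4 * (k * N) * s ≡ 4 * (k * (N * s))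
    rearrange′ = solve-∀
  result : Σ Bool λ b → Σ (VSet n (suc m)) λ A′ → (∀ x → A′ x ≡ true → A x ≡ true × μ x ≡ b) ×
    Thick h A′ × size A ≤ 4 * size A′
  result with prune h (suc (size P)) P ≤-refl
  ... | A′ , A′⊆ , thick , excess = b , A′ , (λ x A′x → P⊆ x (A′⊆ x A′x)) , thick ,
    -- A copy of `H * size A` is added to both sides, so that four times the projection term, at
    -- most `H * size A`, cancels without subtraction.
    *-cancelˡ-≤ H {{m^n≢0 2 h}} (+-cancelʳ-≤ (H * size A) _ _ (begin
      H * size A + H * size A                    ≡⟨ double H (size A) ⟩
      2 * (H * size A)                           ≤⟨ *-monoʳ-≤ 2 (*-monoʳ-≤ H A≤2P) ⟩
      2 * (H * (2 * size P))              ≡⟨ quadruple H (size P) ⟩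
      4 * (H * size P)                    ≤⟨ *-monoʳ-≤ 4 (m≤m+n (H * size P) (N * projSum A′)) ⟩
      4 * (H * size P + N * projSum A′)   ≤⟨ *-monoʳ-≤ 4 excess ⟩
      4 * (H * size A′ + N * projSum P)   ≤⟨ *-monoʳ-≤ 4 (+-monoʳ-≤ (H * size A′) (*-monoʳ-≤ N
                                                      (∑-mono (allFin (suc m)) λ i → size-mono (proj-mono i (λ x eq → proj₁ (P⊆ x eq)))))) ⟩
      4 * (H * size A′ + N * projSum A)          ≡⟨ distribute H (size A′) (N * projSum A) ⟩
      H * (4 * size A′) + 4 * (N * projSum A)    ≤⟨ +-monoʳ-≤ (H * (4 * size A′)) projSum≤ ⟩
      H * (4 * size A′) + H * size A             ∎))
    where
    open ≤-Reasoning
    double : ∀ H s → H * s + H * s ≡ 2 * (H * s)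
    double = solve-∀
    quadruple : ∀ H s → 2 * (H * (2 * s)) ≡ 4 * (H * s)
    quadruple = solve-∀
    distribute : ∀ H s t → 4 * (H * s + t) ≡ H * (4 * s) + 4 * t
    distribute = solve-∀

-- The simulation

-- The falling factorial `m (m - 1) ... (m - q + 1)`, which is zero for `q > m`.
falling : ℕ → ℕ → ℕ
falling m       zero    = 1
falling zero    (suc q) = 0
falling (suc m) (suc q) = suc m * falling m q

-- Here `s` is the number of pairs in the current rectangle, `d` bounds the bits still to come and
-- `q` is the depth of the tree built. Dividing by `(2 ^ n * 2 ^ n) ^ m` turns this into a bound on
-- the density within the coordinates not yet queried.
record Bound (n h m d q s : ℕ) : Set where
  constructor bounded
  field
    bound : s * (5 * 2 ^ h) ^ q ≤ 4 ^ d * ((2 ^ n * 2 ^ n) ^ m * (24 ^ q * falling m q))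

-- A query multiplies the density by at least `5 * 2 ^ h / (24 * suc m)`: the factor `2 ^ n * 2 ^ n`
-- is absorbed by the removed coordinate, and `suc m` becomes the leading factor of the falling
-- factorial.
Bound-query : ∀ {n h m d q s s′} → 5 * (2 ^ h * s) ≤ 24 * (suc m * ((2 ^ n * 2 ^ n) * s′)) →
              Bound n h m d q s′ → Bound n h (suc m) d (suc q) s
Bound-query {n} {h} {m} {d} {q} {s} {s′} step (bounded bound) = bounded (begin
  s * (5 * H * (5 * H) ^ q)              ≡⟨ e₁ s H ((5 * H) ^ q) ⟩
  5 * (H * s) * (5 * H) ^ q              ≤⟨ *-monoˡ-≤ ((5 * H) ^ q) step ⟩
  24 * (suc m * (M * s′)) * (5 * H) ^ q  ≡⟨ e₂ (suc m) M s′ ((5 * H) ^ q) ⟩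
  24 * suc m * M * (s′ * (5 * H) ^ q)    ≤⟨ *-monoʳ-≤ (24 * suc m * M) bound ⟩
  24 * suc m * M * (4 ^ d * (M ^ m * (24 ^ q * falling m q))) ≡⟨ e₃ (suc m) M (4 ^ d) (M ^ m) (24 ^ q) (falling m q) ⟩
  4 ^ d * (M * M ^ m * (24 * 24 ^ q * (suc m * falling m q))) ∎)
  where
  open ≤-Reasoning
  H M : ℕ
  H = 2 ^ h
  M = 2 ^ n * 2 ^ n
  e₁ : ∀ s H r → s * (5 * H * r) ≡ 5 * (H * s) * r
  e₁ = solve-∀
  e₂ : ∀ k M s r → 24 * (k * (M * s)) * r ≡ 24 * k * M * (s * r)
  e₂ = solve-∀
  e₃ : ∀ k M D P r F → 24 * k * M * (D * (P * (r * F))) ≡ D * (M * P * (24 * r * (k * F)))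
  e₃ = solve-∀

Bound-bit : ∀ {n h m d d′ q s s′} → s ≤ 4 * s′ → d′ ≤ d → Bound n h m d′ q s′ → Bound n h m (suc d) q s
Bound-bit {n} {h} {m} {d} {d′} {q} {s} {s′} s≤ d′≤d (bounded bound) = bounded (begin
  s * P                ≤⟨ *-monoˡ-≤ P s≤ ⟩
  4 * s′ * P           ≡⟨ *-assoc 4 s′ P ⟩
  4 * (s′ * P)         ≤⟨ *-monoʳ-≤ 4 (≤-trans bound (*-monoˡ-≤ Q (^-monoʳ-≤ 4 d′≤d))) ⟩
  4 * (4 ^ d * Q)      ≡⟨ *-assoc 4 (4 ^ d) Q ⟨
  4 ^ suc d * Q        ∎)
  where
  open ≤-Reasoning
  P Q : ℕ
  P = (5 * 2 ^ h) ^ q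
  Q = (2 ^ n * 2 ^ n) ^ m * (24 ^ q * falling m q)

^-distribʳ-* : ∀ k a b → (a * b) ^ k ≡ a ^ k * b ^ k
^-distribʳ-* zero    a b = refl
^-distribʳ-* (suc k) a b = trans (cong (a * b *_) (^-distribʳ-* k a b)) (interchange a b (a ^ k) (b ^ k))
  where
  interchange : ∀ a b c d → a * b * (c * d) ≡ a * c * (b * d)
  interchange = solve-∀

-- Without queries the bound follows from a density being at most one.
Bound-leaf : {h d : ℕ} (A B : VSet n m) → Bound n h m d 0 (size A * size B)
Bound-leaf {n} {m} {h} {d} A B = bounded (begin
  size A * size B * 1             ≡⟨ *-identityʳ _ ⟩
  size A * size B                 ≤⟨ *-mono-≤ (size≤full A) (size≤full B) ⟩
  (2 ^ n) ^ m * (2 ^ n) ^ m       ≡⟨ ^-distribʳ-* m (2 ^ n) (2 ^ n) ⟨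
  (2 ^ n * 2 ^ n) ^ m             ≡⟨ *-identityʳ _ ⟨
  (2 ^ n * 2 ^ n) ^ m * 1         ≤⟨ m≤n*m _ (4 ^ d) {{m^n≢0 4 d}} ⟩
  4 ^ d * ((2 ^ n * 2 ^ n) ^ m * 1) ∎)
  where open ≤-Reasoning

Correct : PartialGadget n → Protocol (Vec (Bits n) m) (Vec (Bits n) m) Z → VSet n m → VSet n m → (Vec Bool m → Z) → Set
Correct g Π A B f = ∀ x y z → A x ≡ true → B y ≡ true → liftG g x y ≡ just z → runP Π x y ≡ f z

module Lifting {n : ℕ} (h : ℕ) (g : PartialGadget n) (δ : ℚ) (δ< : δ <ℚ (ℤ.+ 1 / 6))
                  (dists : (c : Bool) → ColourDist g δ h c) where

  restriction-positive : {c : Bool} {i : Fin (suc m)} {A B : VSet n (suc m)} → 1 ≤ size A → 1 ≤ size B →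
    (R : Restriction h g c i A B) → 1 ≤ size (Restriction.A′ R) × 1 ≤ size (Restriction.B′ R)
  restriction-positive {i = i} {A} {B} 1≤A 1≤B R = positive-factorˡ _ _ 1≤A′B′ , positive-factorʳ (size A′) _ 1≤A′B′
    where
    open Restriction R
    1≤A′B′ : 1 ≤ size A′ * size B′
    1≤A′B′ = positive-factorʳ 6 _ (≤-trans
      (*-mono-≤ {1} {5} (s≤s z≤n) (*-mono-≤ (proj-positive i A 1≤A) (proj-positive i B 1≤B))) gain)

  -- One restriction per coordinate fixes its gadget value to the next bit of `z`, and what remains
  -- is again thick and nonempty. Consequently a protocol that is correct on such a rectangle and
  -- has no bits left computes a constant.
  realise : (A B : VSet n m) → Thick h A → Thick h B → 1 ≤ size A → 1 ≤ size B → (z : Vec Bool m) →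
    Σ (Vec (Bits n) m) λ x → Σ (Vec (Bits n) m) λ y → A x ≡ true × B y ≡ true × liftG g x y ≡ just z
  realise A B thickA thickB 1≤A 1≤B [] with nonempty-size A 1≤A | nonempty-size B 1≤B
  ... | [] , Ax | [] , By = [] , [] , Ax , By , refl
  realise A B thickA thickB 1≤A 1≤B (c ∷ z)
    with restrict δ< (dists c) zero A B thickA thickB 1≤A 1≤B
  ... | R with restriction-positive 1≤A 1≤B R
  ...   | 1≤A′ , 1≤B′ with realise (Restriction.A′ R) (Restriction.B′ R)
                                 (Restriction.thickA′ R) (Restriction.thickB′ R) 1≤A′ 1≤B′ z
  ...     | x , y , A′x , B′y , xy≡z =
    u x ∷ x , v y ∷ y , u∈ x A′x , v∈ y B′y , liftG-insertAt g zero x y xy≡z (colour x y A′x B′y)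
    where open Restriction R

  record Progress {m : ℕ} (A B : VSet n (suc m)) (i : Fin (suc m)) : Set where
    constructor progressing
    field
      progress : 2 ^ h * (size A * size B) ≤ 4 * (suc m * ((2 ^ n * 2 ^ n) * (size (proj i A) * size (proj i B))))

  progress? : (A B : VSet n (suc m)) → Dec (∃ (Progress A B))
  progress? A B = any? (λ i → Dec.map′ progressing Progress.progress (_ ≤? _))

  -- If the inequality failed at `i`, multiplying the reverse one by
  -- `size B ≤ 2 ^ n * size (proj i B)` would give progress at `i`.
  stuckˡ : (A B : VSet n (suc m)) → ¬ ∃ (Progress A B) →
           ∀ i → 4 * (suc m * (2 ^ n * size (proj i A))) ≤ 2 ^ h * size A
  stuckˡ {m} A B stuck i with ≤-total (4 * (suc m * (2 ^ n * size (proj i A)))) (2 ^ h * size A)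
  ... | inj₁ le = le
  ... | inj₂ ge = contradiction (i , fat) stuck
    where
    open ≤-Reasoning
    N : ℕ
    N = 2 ^ n
    rearrange : ∀ k N a b → 4 * (k * (N * a)) * (N * b) ≡ 4 * (k * ((N * N) * (a * b)))
    rearrange = solve-∀
    fat : Progress A B i
    fat = progressing (begin
      2 ^ h * (size A * size B)                                      ≡⟨ *-assoc (2 ^ h) (size A) (size B) ⟨
      2 ^ h * size A * size B                                        ≤⟨ *-mono-≤ ge (size≤proj i B) ⟩
      4 * (suc m * (N * size (proj i A))) * (N * size (proj i B))    ≡⟨ rearrange (suc m) N (size (proj i A)) (size (proj i B)) ⟩
      4 * (suc m * ((N * N) * (size (proj i A) * size (proj i B))))  ∎)

  stuckʳ : (A B : VSet n (suc m)) → ¬ ∃ (Progress A B) →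
           ∀ i → 4 * (suc m * (2 ^ n * size (proj i B))) ≤ 2 ^ h * size B
  stuckʳ {m} A B stuck = stuckˡ B A λ (i , progressing fat) → stuck (i , progressing (subst₂
    (λ s t → 2 ^ h * s ≤ 4 * (suc m * ((2 ^ n * 2 ^ n) * t)))
    (*-comm (size B) (size A)) (*-comm (size (proj i B)) (size (proj i A))) fat))

  Simulated : (m d s : ℕ) → (Vec Bool m → Z) → Set
  Simulated {Z} m d s f = Σ (DecTree m Z) λ t → ComputesDT f t × Bound n h m d (depthDT t) s

  restricted : {c : Bool} {i : Fin (suc m)} {A B : VSet n (suc m)} → Restriction h g c i A B →
    Protocol (Vec (Bits n) (suc m)) (Vec (Bits n) (suc m)) Z → Protocol (Vec (Bits n) m) (Vec (Bits n) m) Z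
  restricted {i = i} R = mapP (λ x → insertAt x i (Restriction.u R x)) (λ y → insertAt y i (Restriction.v R y))

  restricted-correct : {c : Bool} {i : Fin (suc m)} {A B : VSet n (suc m)} (R : Restriction h g c i A B)
    (Π : Protocol (Vec (Bits n) (suc m)) (Vec (Bits n) (suc m)) Z) {f : Vec Bool (suc m) → Z} → Correct g Π A B f →
    Correct g (restricted R Π) (Restriction.A′ R) (Restriction.B′ R) (λ z → f (insertAt z i c))
  restricted-correct {i = i} R Π correct x y z A′x B′y xy≡z = trans (runP-mapP _ _ Π x y)
    (correct _ _ _ (u∈ x A′x) (v∈ y B′y) (liftG-insertAt g i x y xy≡z (colour x y A′x B′y)))
    where open Restriction R

  query-step : {d : ℕ} {f : Vec Bool (suc m) → Z} {A B : VSet n (suc m)} {i : Fin (suc m)} → Progress A B i →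
    (R : ∀ c → Restriction h g c i A B) →
    (∀ c → Simulated m d (size (Restriction.A′ (R c)) * size (Restriction.B′ (R c))) (λ z → f (insertAt z i c))) →
    Simulated (suc m) d (size A * size B) f
  query-step {m} {Z} {d} {f} {A} {B} {i} (progressing progress) R child =
    queryAt i tree , queryAt-computes f i tree (λ c → proj₁ (proj₂ (child c))) , bound
    where
    tree : Bool → DecTree m Z
    tree c = proj₁ (child c)
    module R c = Restriction (R c)
    step : ∀ c → 5 * (2 ^ h * (size A * size B)) ≤ 24 * (suc m * ((2 ^ n * 2 ^ n) * (size (R.A′ c) * size (R.B′ c))))
    -- The factor 24 is the 4 of `progress` times the 6 of `gain`.
    step c = begin
      5 * (2 ^ h * (size A * size B))                               ≤⟨ *-monoʳ-≤ 5 progress ⟩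
      5 * (4 * (suc m * (M * (size (proj i A) * size (proj i B))))) ≡⟨ e₁ (suc m) M (size (proj i A) * size (proj i B)) ⟩
      4 * (suc m * M) * (5 * (size (proj i A) * size (proj i B)))   ≤⟨ *-monoʳ-≤ (4 * (suc m * M)) (R.gain c) ⟩
      4 * (suc m * M) * (6 * (size (R.A′ c) * size (R.B′ c)))       ≡⟨ e₂ (suc m) M (size (R.A′ c) * size (R.B′ c)) ⟩
      24 * (suc m * (M * (size (R.A′ c) * size (R.B′ c))))          ∎
      where
      open ≤-Reasoning
      M : ℕ
      M = 2 ^ n * 2 ^ n
      e₁ : ∀ k M s → 5 * (4 * (k * (M * s))) ≡ 4 * (k * M) * (5 * s)
      e₁ = solve-∀
      e₂ : ∀ k M s → 4 * (k * M) * (6 * s) ≡ 24 * (k * (M * s))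
      e₂ = solve-∀
    bound : Bound n h (suc m) d (depthDT (queryAt i tree)) (size A * size B)
    bound = let (c , eq) = queryAt-depth i tree in
      subst (λ q → Bound n h (suc m) d q (size A * size B)) (sym eq) (Bound-query (step c) (proj₂ (proj₂ (child c))))

  bit-step : {d d′ s s′ : ℕ} {f : Vec Bool m → Z} → s ≤ 4 * s′ → d′ ≤ d → Simulated m d′ s′ f → Simulated m (suc d) s f
  bit-step s≤ d′≤d (t , computes , bound) = t , computes , Bound-bit s≤ d′≤d bound

  alice-step : (A B : VSet n (suc m)) (f : Vec Bool (suc m) → Z) (μ : Vec (Bits n) (suc m) → Bool)
    {Π₀ Π₁ : Protocol (Vec (Bits n) (suc m)) (Vec (Bits n) (suc m)) Z} →
    (∀ i → 4 * (suc m * (2 ^ n * size (proj i A))) ≤ 2 ^ h * size A) → 1 ≤ size A → Correct g (alice μ Π₀ Π₁) A B f →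
    (∀ b A′ → Thick h A′ → 1 ≤ size A′ → Correct g (branch b Π₀ Π₁) A′ B f →
      Simulated (suc m) (depthP (branch b Π₀ Π₁)) (size A′ * size B) f) →
    Simulated (suc m) (depthP (alice μ Π₀ Π₁)) (size A * size B) f
  alice-step A B f μ {Π₀} {Π₁} spread 1≤A correct rec =
    let (b , A′ , A′⊆ , thick , A≤4A′) = halve h A μ spread in
    bit-step (≤-trans (*-monoˡ-≤ (size B) A≤4A′) (≤-reflexive (*-assoc 4 (size A′) (size B)))) (depthP-branch b Π₀ Π₁)
      (rec b A′ thick (positive-factorʳ 4 _ (≤-trans 1≤A A≤4A′)) λ x y z A′x By xy≡z →
        trans (sym (runP-alice μ x y (proj₂ (A′⊆ x A′x)))) (correct x y z (proj₁ (A′⊆ x A′x)) By xy≡z))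

  bob-step : (A B : VSet n (suc m)) (f : Vec Bool (suc m) → Z) (μ : Vec (Bits n) (suc m) → Bool)
    {Π₀ Π₁ : Protocol (Vec (Bits n) (suc m)) (Vec (Bits n) (suc m)) Z} →
    (∀ i → 4 * (suc m * (2 ^ n * size (proj i B))) ≤ 2 ^ h * size B) → 1 ≤ size B → Correct g (bob μ Π₀ Π₁) A B f →
    (∀ b B′ → Thick h B′ → 1 ≤ size B′ → Correct g (branch b Π₀ Π₁) A B′ f →
      Simulated (suc m) (depthP (branch b Π₀ Π₁)) (size A * size B′) f) →
    Simulated (suc m) (depthP (bob μ Π₀ Π₁)) (size A * size B) f
  bob-step A B f μ {Π₀} {Π₁} spread 1≤B correct rec =
    let (b , B′ , B′⊆ , thick , B≤4B′) = halve h B μ spread in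
    bit-step (≤-trans (*-monoʳ-≤ (size A) B≤4B′) (≤-reflexive (pull4 (size A) (size B′)))) (depthP-branch b Π₀ Π₁)
      (rec b B′ thick (positive-factorʳ 4 _ (≤-trans 1≤B B≤4B′)) λ x y z Ax B′y xy≡z →
        trans (sym (runP-bob μ x y (proj₂ (B′⊆ y B′y)))) (correct x y z Ax (proj₁ (B′⊆ y B′y)) xy≡z))
    where
    pull4 : ∀ a b → a * (4 * b) ≡ 4 * (a * b)
    pull4 = solve-∀

  Simulates : Set → ℕ → Set
  Simulates Z m = (Π : Protocol (Vec (Bits n) m) (Vec (Bits n) m) Z) (A B : VSet n m) (f : Vec Bool m → Z) →
    Thick h A → Thick h B → 1 ≤ size A → 1 ≤ size B → Correct g Π A B f → Simulated m (depthP Π) (size A * size B) f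

  -- Two nested inductions: a query removes a coordinate and hands the restricted protocol, of
  -- unchanged depth, to `rec`; a bit stays at `suc m` and recurses on a subprotocol.
  simulate-suc : Simulates Z m → Simulates Z (suc m)
  simulate-suc {m = m} rec Π A B f thickA thickB 1≤A 1≤B correct with progress? A B
  ... | yes (i , progress) = query-step progress R λ c →
    let (1≤A′ , 1≤B′) = restriction-positive 1≤A 1≤B (R c) in
    subst (λ d → Simulated m d (size (Restriction.A′ (R c)) * size (Restriction.B′ (R c))) (λ z → f (insertAt z i c)))
      (depthP-mapP _ _ Π)
      (rec (restricted (R c) Π) (Restriction.A′ (R c)) (Restriction.B′ (R c)) (λ z → f (insertAt z i c))
        (Restriction.thickA′ (R c)) (Restriction.thickB′ (R c)) 1≤A′ 1≤B′ (restricted-correct (R c) Π correct))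
    where
    R : (c : Bool) → Restriction h g c i A B
    R c = restrict δ< (dists c) i A B thickA thickB 1≤A 1≤B
  simulate-suc rec (out z) A B f thickA thickB 1≤A 1≤B correct | no _ =
    leaf z , constant , Bound-leaf A B
    where
    constant : ∀ w → z ≡ f w
    -- No bits are left, and every `w` occurs in the rectangle, so the announced `z` is the value
    -- everywhere.
    constant w = let (x , y , Ax , By , xy≡w) = realise A B thickA thickB 1≤A 1≤B w in correct x y w Ax By xy≡w
  simulate-suc rec (alice μ Π₀ Π₁) A B f thickA thickB 1≤A 1≤B correct | no stuck =
    alice-step A B f μ (stuckˡ A B stuck) 1≤A correct λ
      { false A′ thickA′ 1≤A′ → simulate-suc rec Π₀ A′ B f thickA′ thickB 1≤A′ 1≤B
      ; true  A′ thickA′ 1≤A′ → simulate-suc rec Π₁ A′ B f thickA′ thickB 1≤A′ 1≤B }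
  simulate-suc rec (bob μ Π₀ Π₁) A B f thickA thickB 1≤A 1≤B correct | no stuck =
    bob-step A B f μ (stuckʳ A B stuck) 1≤B correct λ
      { false B′ thickB′ 1≤B′ → simulate-suc rec Π₀ A B′ f thickA thickB′ 1≤A 1≤B′
      ; true  B′ thickB′ 1≤B′ → simulate-suc rec Π₁ A B′ f thickA thickB′ 1≤A 1≤B′ }

  simulate : (m : ℕ) → Simulates Z m
  simulate zero    Π A B f _ _ _ _ _ = leaf (f []) , (λ { [] → refl }) , Bound-leaf A B
  simulate (suc m) = simulate-suc (simulate m)

  -- Protocols of depth at most `h`

  hit-colour : (S T : Subset n) → Dense h S → Dense h T → (c : Bool) →
    Σ (Bits n) λ u → Σ (Bits n) λ v → S u ≡ true × T v ≡ true × g u v ≡ just c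
  hit-colour S T denseS denseT c
    with (σ , hitting , mono) ← dists c
    -- With a single event, `5 ≤ 6 * ind b` leaves only `b = true`; the entry `true` of the list is
    -- a placeholder.
    with good-rectangle σ δ< (λ (_ : Bool) R → intersects R S T) (true ∷ []) (s≤s z≤n) (hitting S T denseS denseT ∷ [])
  ... | (w , U , V) , R∈ , 5≤ with intersects (U , V) S T in eq
  ...   | false with () ← 5≤
  ...   | true with any-true⁻ _ (allBits n) eq
  ...     | u , eqᵤ with any-true⁻ _ (allBits n) eqᵤ
  ...       | v , eqᵥ with ∧-true⁻ {U u} eqᵥ
  ...         | Uu , eq₁ with ∧-true⁻ {S u} eq₁
  ...           | Su , eq₂ with ∧-true⁻ {V v} eq₂
  ...             | Vv , Tv = u , v , Su , Tv , All.lookup mono R∈ u v Uu Vv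

  -- Density at least `2 ^ d / 2 ^ h`: enough to be halved `d` times and still be dense.
  record Ample (d : ℕ) (S : Subset n) : Set where
    constructor ample
    field
      large : 2 ^ d * 2 ^ n ≤ card S * 2 ^ h

  Ample⇒Dense : ∀ {d S} → Ample d S → Dense h S
  Ample⇒Dense {d} (ample large) = ≤-trans (m≤n*m (2 ^ n) (2 ^ d) {{m^n≢0 2 d}}) large

  Ample-anti : ∀ {d d′ S} → d ≤ d′ → Ample d′ S → Ample d S
  Ample-anti d≤d′ (ample large) = ample (≤-trans (*-monoˡ-≤ (2 ^ n) (^-monoʳ-≤ 2 d≤d′)) large)

  Ample-half : ∀ {d S S′} → card S ≤ 2 * card S′ → Ample (suc d) S → Ample d S′
  Ample-half {d} {S} {S′} half (ample large) = ample (*-cancelˡ-≤ 2 (begin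
    2 * (2 ^ d * 2 ^ n)        ≡⟨ *-assoc 2 (2 ^ d) (2 ^ n) ⟨
    2 ^ suc d * 2 ^ n          ≤⟨ large ⟩
    card S * 2 ^ h             ≤⟨ *-monoˡ-≤ (2 ^ h) half ⟩
    2 * card S′ * 2 ^ h        ≡⟨ *-assoc 2 (card S′) (2 ^ h) ⟩
    2 * (card S′ * 2 ^ h)      ∎))
    where open ≤-Reasoning

  larger-subset : (S : Subset n) (μ : Bits n → Bool) → Σ Bool λ b → Σ (Subset n) λ S′ →
    (∀ u → S′ u ≡ true → S u ≡ true × μ u ≡ b) × card S ≤ 2 * card S′
  larger-subset S μ = let (b , S′ , S′⊆ , le) = larger-part (allBits n) S μ in
    b , S′ , S′⊆ , subst₂ (λ k l → k ≤ 2 * l) (sym (card-∑ S)) (sym (card-∑ S′)) le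

  -- A certificate that the protocol cannot tell the two gadget values apart on `S` and `T`.
  record Confused (Π : Protocol (Bits n) (Bits n) Z) (S T : Subset n) : Set where
    constructor confused
    field
      u v : Bool → Bits n
      u∈  : ∀ c → S (u c) ≡ true
      v∈  : ∀ c → T (v c) ≡ true
      colour : ∀ c → g (u c) (v c) ≡ just c
      same   : runP Π (u false) (v false) ≡ runP Π (u true) (v true)

  -- Following the larger part at each bit halves at most one of the sets, and the budget of `Ample`
  -- drops with the depth. Both sets are dense at the leaf, where hitting supplies inputs of either
  -- colour.
  confuse : (Π : Protocol (Bits n) (Bits n) Z) (S T : Subset n) →
    Ample (depthP Π) S → Ample (depthP Π) T → Confused Π S T
  confuse (out z) S T ampleS ampleT = confused
    (λ c → proj₁ (hit c)) (λ c → proj₁ (proj₂ (hit c))) (λ c → proj₁ (proj₂ (proj₂ (hit c))))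
    (λ c → proj₁ (proj₂ (proj₂ (proj₂ (hit c))))) (λ c → proj₂ (proj₂ (proj₂ (proj₂ (hit c))))) refl
    where
    hit : (c : Bool) → Σ (Bits n) λ u → Σ (Bits n) λ v → S u ≡ true × T v ≡ true × g u v ≡ just c
    hit = hit-colour S T (Ample⇒Dense ampleS) (Ample⇒Dense ampleT)
  confuse (alice μ Π₀ Π₁) S T ampleS ampleT with larger-subset S μ
  ... | b , S′ , S′⊆ , half = lift (rec b (Ample-anti (depthP-branch b Π₀ Π₁) (Ample-half half ampleS))
                                          (Ample-anti (m≤n⇒m≤1+n (depthP-branch b Π₀ Π₁)) ampleT))
    where
    rec : ∀ b → Ample (depthP (branch b Π₀ Π₁)) S′ → Ample (depthP (branch b Π₀ Π₁)) T → Confused (branch b Π₀ Π₁) S′ T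
    rec false = confuse Π₀ S′ T
    rec true  = confuse Π₁ S′ T
    lift : Confused (branch b Π₀ Π₁) S′ T → Confused (alice μ Π₀ Π₁) S T
    lift (confused u v u∈ v∈ colour same) = confused u v (λ c → proj₁ (S′⊆ _ (u∈ c))) v∈ colour
      (trans (runP-alice μ _ _ (proj₂ (S′⊆ _ (u∈ false)))) (trans same (sym (runP-alice μ _ _ (proj₂ (S′⊆ _ (u∈ true)))))))
  confuse (bob μ Π₀ Π₁) S T ampleS ampleT with larger-subset T μ
  ... | b , T′ , T′⊆ , half = lift (rec b (Ample-anti (m≤n⇒m≤1+n (depthP-branch b Π₀ Π₁)) ampleS)
                                          (Ample-anti (depthP-branch b Π₀ Π₁) (Ample-half half ampleT)))
    where
    rec : ∀ b → Ample (depthP (branch b Π₀ Π₁)) S → Ample (depthP (branch b Π₀ Π₁)) T′ → Confused (branch b Π₀ Π₁) S T′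
    rec false = confuse Π₀ S T′
    rec true  = confuse Π₁ S T′
    lift : Confused (branch b Π₀ Π₁) S T′ → Confused (bob μ Π₀ Π₁) S T
    lift (confused u v u∈ v∈ colour same) = confused u v u∈ (λ c → proj₁ (T′⊆ _ (v∈ c))) colour
      (trans (runP-bob μ _ _ (proj₂ (T′⊆ _ (v∈ false)))) (trans same (sym (runP-bob μ _ _ (proj₂ (T′⊆ _ (v∈ true)))))))

  -- All blocks but the `i`-th are fixed to a preimage of the other bits of `z`, leaving a protocol
  -- on a single gadget input. Having depth at most `h`, it gives the same output on some input of
  -- each colour.
  insensitive : (Π : Protocol (Vec (Bits n) (suc m)) (Vec (Bits n) (suc m)) Z) (f : Vec Bool (suc m) → Z) →
    ComputesComposed f g Π → depthP Π ≤ h → ∀ i z → f (z [ i ]≔ false) ≡ f (z [ i ]≔ true)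
  insensitive {m} Π f correct d≤h i z
    with realise (λ _ → true) (λ _ → true) (λ _ _ _ → full-dense n h) (λ _ _ _ → full-dense n h)
           (size-nonempty {x = replicate m (replicate n false)} refl) (size-nonempty {x = replicate m (replicate n false)} refl) (removeAt z i)
  ... | x , y , _ , _ , xy≡z = trans (sym (value false)) (trans same (value true))
    where
    φ ψ : Bits n → Vec (Bits n) (suc m)
    φ = insertAt x i
    ψ = insertAt y i
    full-ample : Ample (depthP (mapP φ ψ Π)) (λ _ → true)
    full-ample = ample (begin
      2 ^ depthP (mapP φ ψ Π) * 2 ^ n   ≤⟨ *-monoˡ-≤ (2 ^ n) (^-monoʳ-≤ 2 (≤-trans (≤-reflexive (depthP-mapP φ ψ Π)) d≤h)) ⟩
      2 ^ h * 2 ^ n                     ≡⟨ *-comm (2 ^ h) (2 ^ n) ⟩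
      2 ^ n * 2 ^ h                     ≡⟨ cong (_* 2 ^ h) (full-card n) ⟨
      card {n} (λ _ → true) * 2 ^ h     ∎)
      where open ≤-Reasoning
    open Confused (confuse (mapP φ ψ Π) (λ _ → true) (λ _ → true) full-ample full-ample)
    value : ∀ c → runP (mapP φ ψ Π) (u c) (v c) ≡ f (z [ i ]≔ c)
    value c = trans (runP-mapP φ ψ Π (u c) (v c)) (trans
      (correct _ _ _ (liftG-insertAt g i x y xy≡z (colour c))) (cong f (insertAt-removeAt-≔ z i c)))

-- Entries of the all-false vector are changed one at a time until `z` is reached.
insensitive⇒constant : (f : Vec Bool p → Z) → (∀ i z → f (z [ i ]≔ false) ≡ f (z [ i ]≔ true)) →
                       ∀ z → f (replicate p false) ≡ f z
insensitive⇒constant f ins []      = refl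
insensitive⇒constant f ins (b ∷ z) = trans
  (insensitive⇒constant (λ w → f (false ∷ w)) (λ i w → ins (suc i) (false ∷ w)) z) (head b)
  where
  head : ∀ b → f (false ∷ z) ≡ f (b ∷ z)
  head false = refl
  head true  = ins zero (b ∷ z)

-- From the potential bound to the depth bound

falling-zero : ∀ {m q} → m < q → falling m q ≡ 0
falling-zero {zero}  {suc q} _         = refl
falling-zero {suc m} {suc q} (s≤s m<q) = trans (cong (suc m *_) (falling-zero m<q)) (*-zeroʳ (suc m))

falling-monoˡ : ∀ {m m′} q → m ≤ m′ → falling m q ≤ falling m′ q
falling-monoˡ zero    m≤m′       = ≤-refl
falling-monoˡ (suc q) z≤n        = z≤n
falling-monoˡ (suc q) (s≤s m≤m′) = *-mono-≤ (s≤s m≤m′) (falling-monoˡ q m≤m′)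

falling≤^ : ∀ m q → falling m q ≤ m ^ q
falling≤^ m       zero    = ≤-refl
falling≤^ zero    (suc q) = z≤n
falling≤^ (suc m) (suc q) = *-monoʳ-≤ (suc m) (≤-trans (falling≤^ m q) (^-monoˡ-≤ q (n≤1+n m)))

-- Turns `p * p ≤ 2 ^ h`, the form taken by `p ≤ 2 ^ (h / 2)`, into a numeric cap on `p` for small
-- `h`.
root≤ : ∀ {p h} k → p * p ≤ 2 ^ h → 2 ^ h < suc k * suc k → p ≤ k
root≤ {p} k p²≤ <k² = ≮⇒≥ λ k<p → <⇒≱ <k² (≤-trans (*-mono-≤ k<p k<p) p²≤)

-- The constants 5 and 24 of the potential bound stay variables a and b up to the final case split,
-- since the type checker would unfold products such as 24 ^ 8 * k with k a variable.
queries≤ : ∀ a b .{{_ : NonZero a}} {h p q d} → (a * 2 ^ h) ^ q ≤ 4 ^ d * (b ^ q * falling p q) → q ≤ p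
queries≤ a b {h} {p} {q} {d} bound = ≮⇒≥ λ p<q → <⇒≱
  (m^n>0 (a * 2 ^ h) {{m*n≢0 a (2 ^ h) {{it}} {{m^n≢0 2 h}}}} q)
  (≤-trans bound (≤-reflexive (trans
    (cong (λ k → 4 ^ d * (b ^ q * k)) (falling-zero p<q))
    (trans (cong (4 ^ d *_) (*-zeroʳ (b ^ q))) (*-zeroʳ (4 ^ d))))))

-- The potential bound fails for 9 + r queries among k coordinates if 8 d < h (9 + r).
Separated : ℕ → ℕ → ℕ → ℕ → ℕ → Set
Separated a b h k r = 4 ^ ((h * (9 + r) ∸ 1) /ℕ 8) * (b ^ (9 + r) * falling k (9 + r)) < (a * 2 ^ h) ^ (9 + r)

-- Up to eight queries are covered by `h < d`. Beyond that `q = 9 + r` with `q ≤ p ≤ k`, which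
-- leaves finitely many `r`, each refuted by `separated`.
few-coordinates : ∀ a b .{{_ : NonZero a}} {h p q d} k → p ≤ k → (∀ {r} → r < k ∸ 8 → Separated a b h k r) → h < d →
  (a * 2 ^ h) ^ q ≤ 4 ^ d * (b ^ q * falling p q) → h * q ≤ 8 * d
few-coordinates a b {h} {p} {q} {d} k p≤k separated h<d bound with q ≤? 8
... | yes q≤8 = begin
  h * q ≤⟨ *-monoʳ-≤ h q≤8 ⟩
  h * 8 ≡⟨ *-comm h 8 ⟩
  8 * h ≤⟨ *-monoʳ-≤ 8 (<⇒≤ h<d) ⟩
  8 * d ∎
  where open ≤-Reasoning
... | no q≰8 with q ∸ 9 | m+[n∸m]≡n (≰⇒> q≰8)
...   | r | refl = ≮⇒≥ λ 8d<hq → <⇒≱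
  (separated (≤-trans (≤-reflexive (sym (m+n∸m≡n 8 (suc r)))) (∸-monoˡ-≤ 8
    (subst (_≤ k) (sym (+-suc 8 r)) (≤-trans (queries≤ a b {h} {p} {9 + r} {d} bound) p≤k)))))
  (≤-trans bound (*-mono-≤ (^-monoʳ-≤ 4 (d≤ 8d<hq)) (*-monoʳ-≤ (b ^ (9 + r)) (falling-monoˡ (9 + r) p≤k))))
  where
  -- The largest `d` with `8 * d < h * (9 + r)` is the floor of `(h * (9 + r) - 1) / 8`, so this
  -- exponent covers the worst case.
  d≤ : 8 * d < h * (9 + r) → d ≤ (h * (9 + r) ∸ 1) /ℕ 8
  d≤ lt = begin
    d                          ≡⟨ m*n/n≡m d 8 ⟨
    d * 8 /ℕ 8                  ≡⟨ cong (_/ℕ 8) (*-comm d 8) ⟩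
    8 * d /ℕ 8                  ≤⟨ /-monoˡ-≤ 8 (∸-monoˡ-≤ 1 lt) ⟩
    (h * (9 + r) ∸ 1) /ℕ 8      ∎
    where open ≤-Reasoning

-- Suppose `8 * d < h * q` and take the eighth power of the bound. With `p ^ 8 ≤ H ^ 4` and
-- `4 ^ h = H ^ 2`, it makes `(a * H) ^ (8 * q)` less than `(b ^ 8 * H ^ 6) ^ q`, contrary to
-- `b ^ 8 ≤ a ^ 8 * 4 ^ 10 ≤ a ^ 8 * H ^ 2`.
many-coordinates : ∀ a b .{{_ : NonZero b}} → b ^ 8 ≤ a ^ 8 * 4 ^ 10 → ∀ {h p q d} → 10 ≤ h → p * p ≤ 2 ^ h →
  (a * 2 ^ h) ^ q ≤ 4 ^ d * (b ^ q * falling p q) → h * q ≤ 8 * d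
many-coordinates a b b⁸≤ {h} {p} {q} {d} 10≤h p²≤ bound = ≮⇒≥ λ 8d<hq → <-irrefl refl (smaller 8d<hq)
  where
  open ≤-Reasoning
  H : ℕ
  H = 2 ^ h
  instance
    H≢0 : NonZero H
    H≢0 = m^n≢0 2 h
  powers : ∀ c → (c ^ q) ^ 8 ≡ (c ^ 8) ^ q
  powers c = trans (^-*-assoc c q 8) (trans (cong (c ^_) (*-comm q 8)) (sym (^-*-assoc c 8 q)))
  K : ℕ
  K = b ^ 8 * H ^ 4
  [bp]^8≤K : (b * p) ^ 8 ≤ K
  [bp]^8≤K = begin
    (b * p) ^ 8            ≡⟨ ^-distribʳ-* 8 b p ⟩
    b ^ 8 * p ^ 8          ≡⟨ cong (b ^ 8 *_) (^-*-assoc p 2 4) ⟨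
    b ^ 8 * (p ^ 2) ^ 4    ≤⟨ *-monoʳ-≤ (b ^ 8) (^-monoˡ-≤ 4 (≤-trans (≤-reflexive (cong (p *_) (*-identityʳ p))) p²≤)) ⟩
    b ^ 8 * H ^ 4          ∎
  4^h≡H² : 4 ^ h ≡ H ^ 2
  4^h≡H² = trans (^-*-assoc 2 2 h) (trans (cong (2 ^_) (*-comm 2 h)) (sym (^-*-assoc 2 h 2)))
  instance
    K^q≢0 : NonZero (K ^ q)
    K^q≢0 = m^n≢0 K q {{m*n≢0 (b ^ 8) (H ^ 4) {{m^n≢0 b 8}} {{m^n≢0 H 4}}}}
  4^hK≤ : 4 ^ h * K ≤ (a * H) ^ 8
  4^hK≤ = begin
    4 ^ h * (b ^ 8 * H ^ 4)             ≡⟨ cong (_* K) 4^h≡H² ⟩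
    H ^ 2 * (b ^ 8 * H ^ 4)             ≡⟨ e₁ (b ^ 8) (H ^ 2) (H ^ 4) ⟩
    b ^ 8 * (H ^ 2 * H ^ 4)             ≤⟨ *-monoˡ-≤ (H ^ 2 * H ^ 4) b⁸≤ ⟩
    a ^ 8 * 4 ^ 10 * (H ^ 2 * H ^ 4)     ≤⟨ *-monoˡ-≤ (H ^ 2 * H ^ 4) (*-monoʳ-≤ (a ^ 8) (^-monoʳ-≤ 4 10≤h)) ⟩
    a ^ 8 * 4 ^ h * (H ^ 2 * H ^ 4)      ≡⟨ cong (λ k → a ^ 8 * k * (H ^ 2 * H ^ 4)) 4^h≡H² ⟩
    a ^ 8 * H ^ 2 * (H ^ 2 * H ^ 4)      ≡⟨ *-assoc (a ^ 8) (H ^ 2) (H ^ 2 * H ^ 4) ⟩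
    a ^ 8 * (H ^ 2 * (H ^ 2 * H ^ 4))    ≡⟨ cong (λ k → a ^ 8 * (H ^ 2 * k)) (^-distribˡ-+-* H 2 4) ⟨
    a ^ 8 * (H ^ 2 * H ^ 6)              ≡⟨ cong (a ^ 8 *_) (^-distribˡ-+-* H 2 6) ⟨
    a ^ 8 * H ^ 8                        ≡⟨ ^-distribʳ-* 8 a H ⟨
    (a * H) ^ 8                          ∎
    where
    e₁ : ∀ a b c → b * (a * c) ≡ a * (b * c)
    e₁ = solve-∀
  smaller : 8 * d < h * q → ((a * H) ^ 8) ^ q < ((a * H) ^ 8) ^ q
  smaller 8d<hq = begin-strict
    ((a * H) ^ 8) ^ q                  ≡⟨ powers (a * H) ⟨
    ((a * H) ^ q) ^ 8                  ≤⟨ ^-monoˡ-≤ 8 (≤-trans bound (*-monoʳ-≤ (4 ^ d) (*-monoʳ-≤ (b ^ q) (falling≤^ p q)))) ⟩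
    (4 ^ d * (b ^ q * p ^ q)) ^ 8     ≡⟨ cong (λ k → (4 ^ d * k) ^ 8) (^-distribʳ-* q b p) ⟨
    (4 ^ d * (b * p) ^ q) ^ 8         ≡⟨ ^-distribʳ-* 8 (4 ^ d) ((b * p) ^ q) ⟩
    (4 ^ d) ^ 8 * ((b * p) ^ q) ^ 8   ≡⟨ cong₂ _*_ (trans (^-*-assoc 4 d 8) (cong (4 ^_) (*-comm d 8))) (powers (b * p)) ⟩
    4 ^ (8 * d) * ((b * p) ^ 8) ^ q   ≤⟨ *-monoʳ-≤ (4 ^ (8 * d)) (^-monoˡ-≤ q [bp]^8≤K) ⟩
    4 ^ (8 * d) * K ^ q                <⟨ *-monoˡ-< (K ^ q) (^-monoʳ-< 4 (s≤s (s≤s z≤n)) 8d<hq) ⟩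
    4 ^ (h * q) * K ^ q                ≡⟨ cong (_* K ^ q) (^-*-assoc 4 h q) ⟨
    (4 ^ h) ^ q * K ^ q                ≡⟨ ^-distribʳ-* q (4 ^ h) K ⟨
    (4 ^ h * K) ^ q                    ≤⟨ ^-monoˡ-≤ q 4^hK≤ ⟩
    ((a * H) ^ 8) ^ q                  ∎

separated? : ∀ h k r → Dec (Separated 5 24 h k r)
separated? h k r = _ <? _

-- For `h` up to 9 the cap on `p` leaves a finite check; from 10 on the general estimate applies,
-- ten being the least `h` with `24 ^ 8 ≤ 5 ^ 8 * 4 ^ h`.
depth-bound : ∀ h {p q d} → p * p ≤ 2 ^ h → h < d →
  (5 * 2 ^ h) ^ q ≤ 4 ^ d * (24 ^ q * falling p q) → h * q ≤ 8 * d
depth-bound h {p} {q} {d} p²≤ h<d bound with h ≤? 6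
... | yes h≤6 = few-coordinates 5 24 {h} 8
  -- `2 ^ 6 < 9 * 9` gives `p ≤ 8`, so more than eight queries are impossible and no case remains to
  -- check.
  (root≤ {h = h} 8 p²≤ (<-≤-trans (s≤s (^-monoʳ-≤ 2 h≤6)) (≤ᵇ⇒≤ 65 81 tt))) (λ ()) h<d bound
... | no h≰6 with m≤n⇒m<n∨m≡n (≰⇒> h≰6)
...   | inj₂ refl = few-coordinates 5 24 {7} {p} {q} {d} 11 (root≤ {h = 7} 11 p²≤ (<ᵇ⇒< 128 144 tt))
                      -- The values `r < 3`, that is 9 to 11 queries, are decided by computation;
                      -- the next two cases do the same up to 16 and 22 queries.
                      (toWitness {a? = allUpTo? (separated? 7 11) 3} tt) h<d bound
...   | inj₁ 7<h with m≤n⇒m<n∨m≡n 7<h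
...     | inj₂ refl = few-coordinates 5 24 {8} {p} {q} {d} 16 (root≤ {h = 8} 16 p²≤ (<ᵇ⇒< 256 289 tt))
                        (toWitness {a? = allUpTo? (separated? 8 16) 8} tt) h<d bound
...     | inj₁ 8<h with m≤n⇒m<n∨m≡n 8<h
...       | inj₂ refl = few-coordinates 5 24 {9} {p} {q} {d} 22 (root≤ {h = 9} 22 p²≤ (<ᵇ⇒< 512 529 tt))
                          (toWitness {a? = allUpTo? (separated? 9 22) 14} tt) h<d bound
...       | inj₁ 9<h = many-coordinates 5 24 (≤ᵇ⇒≤ (24 ^ 8) (5 ^ 8 * 4 ^ 10) tt) {h} {p} {q} {d} 9<h p²≤ bound

-- Derivation of the theorem

open import Data.Integer using (+_)

theorem2 : (n h p : ℕ) → 1 ≤ n → 1 ≤ h → 1 ≤ p →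
    (δ : ℚ) → 0ℚ ≤ℚ δ → δ <ℚ (+ 1 / 6) →
    (Z : Set) (f : Vec Bool p → Z) (g : PartialGadget n) →
    HasHittingMonoDists g δ h →
    p * p ≤ 2 ^ h →
    (Π : Protocol (Vec (Bits n) p) (Vec (Bits n) p) Z) → ComputesComposed f g Π →
    Σ (DecTree p Z) λ T → ComputesDT f T × (h * depthDT T ≤ 8 * depthP Π)
theorem2 n h p@(suc _) _ _ _ δ _ δ< Z f g (σ₀ , σ₁ , (hit₀ , mono₀) , (hit₁ , mono₁)) p²≤ Π correct = result
  where
  dists : (c : Bool) → ColourDist g δ h c
  dists false = σ₀ , hit₀ , mono₀
  dists true  = σ₁ , hit₁ , mono₁
  full : VSet n p
  full _ = true
  full-thick : Thick h full
  full-thick _ _ _ = full-dense n h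
  1≤full : 1 ≤ size full
  1≤full = size-nonempty {x = replicate p (replicate n false)} refl
  M : ℕ
  M = (2 ^ n * 2 ^ n) ^ p
  -- `M` is the number of pairs in the full rectangle, whose density is one; dividing by it leaves a
  -- purely numerical bound.
  cancel : ∀ {q d} → Bound n h p d q (size full * size full) → (5 * 2 ^ h) ^ q ≤ 4 ^ d * (24 ^ q * falling p q)
  cancel {q} {d} (bounded bound) = *-cancelˡ-≤ M {{m^n≢0 (2 ^ n * 2 ^ n) p {{m*n≢0 (2 ^ n) (2 ^ n) {{m^n≢0 2 n}} {{m^n≢0 2 n}}}}}} (begin
    M * (5 * 2 ^ h) ^ q                      ≡⟨ cong (_* (5 * 2 ^ h) ^ q) area ⟨
    size full * size full * (5 * 2 ^ h) ^ q  ≤⟨ bound ⟩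
    4 ^ d * (M * (24 ^ q * falling p q))     ≡⟨ exch (4 ^ d) M (24 ^ q * falling p q) ⟩
    M * (4 ^ d * (24 ^ q * falling p q))     ∎)
    where
    open ≤-Reasoning
    area : size full * size full ≡ M
    area = trans (cong₂ _*_ (size-full n p) (size-full n p)) (sym (^-distribʳ-* p (2 ^ n) (2 ^ n)))
    exch : ∀ a b c → a * (b * c) ≡ b * (a * c)
    exch = solve-∀
  result : Σ (DecTree p Z) λ T → ComputesDT f T × (h * depthDT T ≤ 8 * depthP Π)
  -- With at most `h` bits `f` is constant and a leaf suffices. Otherwise `depthP Π` exceeds `h`,
  -- which `depth-bound` uses, when `h` is small, for trees of at most eight queries.
  result with depthP Π ≤? h
  ... | yes d≤h = leaf (f (replicate p false)) ,
    insensitive⇒constant f (Lifting.insensitive h g δ δ< dists Π f correct d≤h) ,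
    ≤-trans (≤-reflexive (*-zeroʳ h)) z≤n
  ... | no d≰h with Lifting.simulate h g δ δ< dists p Π full full f full-thick full-thick 1≤full 1≤full
                      (λ x y z _ _ → correct x y z)
  ...   | t , computes , bound = t , computes , depth-bound h p²≤ (≰⇒> d≰h) (cancel bound)
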